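{- For $n\ge3$, let $D_n=\langle a,b\mid a^n=b^2=e,\ ba=a^{n-1}b\rangle$ be the dihedral group of order $2n$. In the directed Cayley graph $\Gamma(D_n,\{a,b\})$ the Lin--Lu--Yau Ricci curvatures of the arcs $(e,a)$ and $(e,b)$ are $$\kappa(e,a)=\begin{cases}-\tfrac12,& n=3,\\ -1,& n\ge4,\end{cases}\qquad \kappa(e,b)=\begin{cases}\tfrac12,& n=3,\\ 0,& n\ge4.\end{cases}$$
   Context: For a group $G$ with identity $e$ and a finite set $S\subseteq G\setminus\{e\}$, the directed Cayley graph $\Gamma(G,S)$ has vertex set $G$ and arcs $(g,gs)$ for $g\in G$, $s\in S$. In a simple directed graph $(V,\mathcal A)$, $N^{\rm out}(x)=\{v\in V:(x,v)\in\mathcal A\}$, $d^{\rm out}_x=|N^{\rm out}(x)|$, and $d(x,y)$ is the length of a shortest directed path from $x$ to $y$. For $\alpha\in[0,1]$, the $\alpha$-lazy random walk measure at $x$ is $\mu^\alpha_x(x)=\alpha$, $\mu^\alpha_x(v)=\frac{1-\alpha}{d^{\rm out}_x}$ if $(x,v)\in\mathcal A$, and $\mu_x^\alpha(v)=0$ otherwise. For probability measures $\mu,\nu$ on $V$, $W(\mu,\nu)=\inf_A\sum_{u,v\in V}A(u,v)d(u,v)$, the infimum over couplings $A:V\times V\to[0,1]$ with $\sum_{v}A(u,v)=\mu(u)$ for all $u$ and $\sum_uA(u,v)=\nu(v)$ for all $v$. For distinct $x,y$, $\kappa_\alpha(x,y)=1-\frac{W(\mu_x^\alpha,\mu_y^\alpha)}{d(x,y)}$,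 and the Lin--Lu--Yau Ricci curvature is $\kappa(x,y)=\lim_{\alpha\to1^- }\frac{\kappa_\alpha(x,y)}{1-\alpha}$. -}

module Defs where

open import Level using (Level; _⊔_; 0ℓ) renaming (suc to lsuc)
open import Algebra.Apartness.Bundles using (HeytingCommutativeRing; HeytingField)
open import Algebra.Bundles using (CommutativeRing; Group)
open import Data.Empty using (⊥-elim)
open import Data.Fin.Base using (Fin; toℕ; opposite) renaming (zero to fzero; suc to fsuc)
open import Data.Fin.Properties
  using (toℕ-injective; toℕ-fromℕ<; toℕ<n; opposite-involutive; *↔×) renaming (_≟_ to _≟ᶠ_)
open import Data.List.Base using (List; []; _∷_; length; filter; allFin)
open import Data.List.Membership.Propositional using (_∈_)
open import Data.List.Membership.Propositional.Properties using (∈-filter⁺; ∈-allFin)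
open import Data.List.Relation.Unary.All using (All; []; _∷_)
open import Data.List.Relation.Unary.Any as Any using (Any; here; there; any?)
open import Data.Nat.Base as ℕ using (ℕ; zero; suc; NonZero)
open import Data.Nat.DivMod
open import Data.Nat.Properties as ℕₚ using (≤-trans; n≤1+n)
open import Data.Nat.Tactic.RingSolver using (solve-∀)
open import Data.Product.Base using (Σ-syntax; ∃-syntax; _×_; _,_; proj₁; proj₂)
open import Data.Sum.Base using (_⊎_)
open import Function.Base using (_∘_; id; _$_)
open import Function.Bundles using (Inverse)
import Function.Construct.Composition as Compose
import Function.Construct.Symmetry as Symmetry
open import Function.Properties.Inverse using (Inverse⇒Injection)
open import Relation.Binary.Bundles using (Setoid)
open import Relation.Binary.Core using (Rel)
open import Relation.Binary.Definitions using (Decidable; _Respects₂_)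
open import Relation.Binary.PropositionalEquality as ≡ using (_≡_; cong; cong₂)
open import Relation.Binary.Structures using (IsStrictPartialOrder)
open import Relation.Nullary using (¬_; Dec; yes; no)
open import Relation.Nullary.Decidable using (via-injection)
import Algebra.Properties.Group as GroupProperties
import Algebra.Properties.Semiring.Sum as SemiringSum
import Algebra.Properties.Semiring.Mult as SemiringMult
import Relation.Binary.Reasoning.Setoid as SetoidReasoning

private
  variable
    c ℓ ℓ₁ ℓ₂ r v : Level

-- ℝ is presented axiomatically, as a Cauchy complete Archimedean ordered
-- field.  Classically these axioms determine ℝ up to unique isomorphism.
-- Comparability is expressed through the apartness x # y
-- (x < y or y < x), so that Bishop's real numbers are a model too.

record RealNumbers c ℓ₁ ℓ₂ : Set (lsuc (c ⊔ ℓ₁ ⊔ ℓ₂)) where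
  infix 4 _<_ _≤_
  field
    heytingField : HeytingField c ℓ₁ ℓ₂

  open HeytingField heytingField public

  private
    commutativeRing : CommutativeRing c ℓ₁
    commutativeRing = HeytingCommutativeRing.commutativeRing heytingCommutativeRing

  open SemiringSum (CommutativeRing.semiring commutativeRing) public using (sum)
  open SemiringMult (CommutativeRing.semiring commutativeRing) using ()
    renaming (_×_ to _·_)

  fromℕ : ℕ → Carrier
  fromℕ n = n · 1#

  field
    _<_                  : Rel Carrier ℓ₂
    isStrictPartialOrder : IsStrictPartialOrder _≈_ _<_
    <⇒#                  : ∀ {x y} → x < y → x # y
    #⇒<⊎>                : ∀ {x y} → x # y → x < y ⊎ y < x
    0<1                  : 0# < 1#
    +-monoʳ-<            : ∀ z {x y} → x < y → z + x < z + y
    *-positive           : ∀ {x y} → 0# < x → 0# < y → 0# < x * y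
    archimedean          : ∀ x → ∃[ n ] x < fromℕ n

  _≤_ : Rel Carrier ℓ₂
  x ≤ y = ¬ (y < x)

  ∣_-_∣<_ : Carrier → Carrier → Carrier → Set ℓ₂
  ∣ x - y ∣< ε = (x - y < ε) × (y - x < ε)

  IsCauchy : (ℕ → Carrier) → Set (c ⊔ ℓ₂)
  IsCauchy s = ∀ ε → 0# < ε →
    ∃[ N ] ∀ i j → N ℕ.≤ i → N ℕ.≤ j → ∣ s i - s j ∣< ε

  _ConvergesTo_ : (ℕ → Carrier) → Carrier → Set (c ⊔ ℓ₂)
  s ConvergesTo l = ∀ ε → 0# < ε → ∃[ N ] ∀ i → N ℕ.≤ i → ∣ s i - l ∣< ε

  field
    complete : ∀ s → IsCauchy s → ∃[ l ] s ConvergesTo l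

  open IsStrictPartialOrder isStrictPartialOrder public using (<-resp-≈)
    renaming (irrefl to <-irrefl; trans to <-trans)

  -- The quotient x / (y - z) for y apart from z.
  quotient : Carrier → ∀ {y z} → y # z → Carrier
  quotient x y#z = x * proj₁ (#⇒invertible y#z)

  fromℕ-positive : ∀ n → 0# < fromℕ (suc n)
  fromℕ-positive zero    = proj₁ <-resp-≈ (sym (+-identityʳ 1#)) 0<1
  fromℕ-positive (suc n) = <-trans (fromℕ-positive n)
    (proj₁ <-resp-≈ (+-comm _ 1#)
      (proj₂ <-resp-≈ (+-identityʳ _) (+-monoʳ-< (fromℕ (suc n)) 0<1)))

  fromℕ#0 : ∀ n .{{_ : NonZero n}} → fromℕ n # 0#
  fromℕ#0 (suc n) = #-sym (<⇒# (fromℕ-positive n))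

  infixl 7 _/ℕ_
  _/ℕ_ : Carrier → ∀ n .{{_ : NonZero n}} → Carrier
  x /ℕ n = quotient x (fromℕ#0 n)

  ½ : Carrier
  ½ = 1# /ℕ 2

  IsInfimum : (Carrier → Set v) → Carrier → Set (c ⊔ ℓ₂ ⊔ v)
  IsInfimum P w = (∀ x → P x → w ≤ x)
                × (∀ ε → 0# < ε → ∃[ x ] P x × (x < w + ε))

decidableEquality : ∀ {S : Setoid c ℓ} {n} → Inverse (≡.setoid (Fin n)) S →
                    Decidable (Setoid._≈_ S)
decidableEquality enum =
  via-injection (Inverse⇒Injection (Symmetry.inverse enum)) _≟ᶠ_

record FiniteDigraph v ℓ r : Set (lsuc (v ⊔ ℓ ⊔ r)) where
  field
    vertexSetoid : Setoid v ℓ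

  open Setoid vertexSetoid public renaming (Carrier to Vertex)

  field
    order   : ℕ
    enum    : Inverse (≡.setoid (Fin order)) vertexSetoid
    Arc     : Rel Vertex r
    Arc?    : Decidable Arc
    resp    : Arc Respects₂ _≈_
    noLoops : ∀ {x y} → Arc x y → x ≉ y

  open Inverse enum public using () renaming (to to vertex; from to index)

  _≟_ : Decidable _≈_
  _≟_ = decidableEquality enum

  N-out : Vertex → List (Fin order)
  N-out x = filter (λ i → Arc? x (vertex i)) (allFin order)

  d-out : Vertex → ℕ
  d-out x = length (N-out x)

  d-out-nonZero : ∀ {x y} → Arc x y → NonZero (d-out x)
  d-out-nonZero {x} {y} arc =
    nonEmpty (∈-filter⁺ (λ i → Arc? x (vertex i)) (∈-allFin (index y))
      (proj₁ resp (sym (Inverse.inverseˡ enum ≡.refl)) arc))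
    where
    nonEmpty : ∀ {A : Set} {z : A} {zs} → z ∈ zs → NonZero (length zs)
    nonEmpty (here _)  = _
    nonEmpty (there _) = _

  data Walk : Vertex → Vertex → ℕ → Set (v ⊔ ℓ ⊔ r) where
    stop : ∀ {x y} → x ≈ y → Walk x y 0
    step : ∀ {x y z n} → Arc x y → Walk y z n → Walk x z (suc n)

  -- Such a d exists (and is then unique) exactly when the graph is strongly
  -- connected, that is, when all directed distances are finite.
  IsDistance : (Vertex → Vertex → ℕ) → Set (v ⊔ ℓ ⊔ r)
  IsDistance d = ∀ x y → Walk x y (d x y) × (∀ {n} → Walk x y n → d x y ℕ.≤ n)

  distance-nonZero : ∀ {d} → IsDistance d → ∀ {x y} → x ≉ y → NonZero (d x y)
  distance-nonZero {d} isDistance {x} {y} x≉y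
    with d x y | proj₁ (isDistance x y)
  ... | zero  | stop x≈y = ⊥-elim (x≉y x≈y)
  ... | suc _ | _        = _

-- Infima and limits of real numbers are not given by total functions, so W,
-- κ_α and κ are represented by their graphs: each relation below determines
-- its last argument up to ≈, and asserts that the quantity exists.

module Curvature (ℝ : RealNumbers c ℓ₁ ℓ₂) (Γ : FiniteDigraph v ℓ r) where
  open RealNumbers ℝ
  open FiniteDigraph Γ using (Vertex; order; vertex; Arc; Arc?; _≟_; d-out;
    d-out-nonZero; IsDistance; distance-nonZero)
    renaming (_≈_ to _≈ᵛ_; _≉_ to _≉ᵛ_)

  ∑ : (Vertex → Carrier) → Carrier
  ∑ f = sum {order} (f ∘ vertex)

  lazyWalk : Carrier → Vertex → Vertex → Carrier
  lazyWalk α x y = lazy (y ≟ x) (Arc? x y)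
    where
    lazy : Dec (y ≈ᵛ x) → Dec (Arc x y) → Carrier
    lazy (yes _) _         = α
    lazy (no _)  (yes arc) = ((1# - α) /ℕ d-out x) {{d-out-nonZero arc}}
    lazy (no _)  (no _)    = 0#

  record IsCoupling (μ ν : Vertex → Carrier) (A : Vertex → Vertex → Carrier)
                    : Set (c ⊔ ℓ₁ ⊔ ℓ₂ ⊔ v ⊔ ℓ) where
    field
      A-cong    : ∀ {x x′ y y′} → x ≈ᵛ x′ → y ≈ᵛ y′ → A x y ≈ A x′ y′
      0≤A       : ∀ x y → 0# ≤ A x y
      A≤1       : ∀ x y → A x y ≤ 1#
      marginalˡ : ∀ x → ∑ (λ y → A x y) ≈ μ x
      marginalʳ : ∀ y → ∑ (λ x → A x y) ≈ ν y

  module _ (d : Vertex → Vertex → ℕ) where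

    cost : (Vertex → Vertex → Carrier) → Carrier
    cost A = ∑ λ x → ∑ λ y → A x y * fromℕ (d x y)

    IsWasserstein : (μ ν : Vertex → Carrier) → Carrier → Set (c ⊔ ℓ₁ ⊔ ℓ₂ ⊔ v ⊔ ℓ)
    IsWasserstein μ ν = IsInfimum λ t → ∃[ A ] IsCoupling μ ν A × (t ≈ cost A)

    IsLazyCurvature : Carrier → ∀ x y → .{{NonZero (d x y)}} →
                      Carrier → Set (c ⊔ ℓ₁ ⊔ ℓ₂ ⊔ v ⊔ ℓ)
    IsLazyCurvature α x y κα =
      ∃[ w ] IsWasserstein (lazyWalk α x) (lazyWalk α y) w × (κα ≈ 1# - w /ℕ d x y)

  IsRicciCurvature : ∀ x y → x ≉ᵛ y → Carrier → Set (c ⊔ ℓ₁ ⊔ ℓ₂ ⊔ v ⊔ ℓ ⊔ r)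
  IsRicciCurvature x y x≉y κ =
    Σ[ d ∈ (Vertex → Vertex → ℕ) ] Σ[ isDistance ∈ IsDistance d ]
    ∀ ε → 0# < ε → ∃[ δ ] (0# < δ) ×
      (∀ α → 0# ≤ α → (α<1 : α < 1#) → 1# - α < δ →
        ∃[ κα ] IsLazyCurvature d α x y {{distance-nonZero isDistance x≉y}} κα
              × ∣ quotient κα (#-sym (<⇒# α<1)) - κ ∣< ε)

module _ (G : Group c ℓ) where
  open Group G

  CayleyGraph : ∀ {order} → Inverse (≡.setoid (Fin order)) setoid →
                (S : List Carrier) → All (_≉ ε) S → FiniteDigraph c ℓ (c ⊔ ℓ)
  CayleyGraph {order} enum S ε∉S = record
    { vertexSetoid = setoid
    ; order        = order
    ; enum         = enum
    ; Arc          = Arc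
    ; Arc?         = λ g h → any? (λ s → h ≟ (g ∙ s)) S
    ; resp         = (λ h≈k → Any.map (trans (sym h≈k)))
                   , (λ g≈k → Any.map (λ h≈gs → trans h≈gs (∙-congʳ g≈k)))
    ; noLoops      = λ arc g≈h → noLoops g≈h ε∉S arc
    }
    where
    Arc : Rel Carrier (c ⊔ ℓ)
    Arc g h = Any (λ s → h ≈ g ∙ s) S

    _≟_ : Decidable _≈_
    _≟_ = decidableEquality enum

    noLoops : ∀ {g h} → g ≈ h → ∀ {S} → All (_≉ ε) S → ¬ Any (λ s → h ≈ g ∙ s) S
    noLoops g≈h (s≉ε ∷ _) (here h≈gs) =
      s≉ε (GroupProperties.identityʳ-unique G _ _ (trans (sym h≈gs) (sym g≈h)))
    noLoops g≈h (_ ∷ ε∉S) (there arc) = noLoops g≈h ε∉S arc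

infixl 7 _∙_
infix  8 _⁻¹
infixr 8 _^_

data Term (X : Set) : Set where
  gen : X → Term X
  ε   : Term X
  _∙_ : Term X → Term X → Term X
  _⁻¹ : Term X → Term X

_^_ : ∀ {X} → Term X → ℕ → Term X
x ^ zero  = ε
x ^ suc n = x ∙ x ^ n

module Presentation {X : Set} (_R_ : Rel (Term X) 0ℓ) where
  infix 4 _~_

  -- The least group congruence containing R.
  data _~_ : Rel (Term X) 0ℓ where
    relation  : ∀ {x y} → x R y → x ~ y
    refl      : ∀ {x} → x ~ x
    sym       : ∀ {x y} → x ~ y → y ~ x
    trans     : ∀ {x y z} → x ~ y → y ~ z → x ~ z
    ∙-cong    : ∀ {x x′ y y′} → x ~ x′ → y ~ y′ → x ∙ y ~ x′ ∙ y′
    ⁻¹-cong   : ∀ {x y} → x ~ y → x ⁻¹ ~ y ⁻¹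
    assoc     : ∀ x y z → (x ∙ y) ∙ z ~ x ∙ (y ∙ z)
    identityˡ : ∀ x → ε ∙ x ~ x
    identityʳ : ∀ x → x ∙ ε ~ x
    inverseˡ  : ∀ x → x ⁻¹ ∙ x ~ ε
    inverseʳ  : ∀ x → x ∙ x ⁻¹ ~ ε

  group : Group 0ℓ 0ℓ
  group = record
    { Carrier = Term X ; _≈_ = _~_ ; _∙_ = _∙_ ; ε = ε ; _⁻¹ = _⁻¹
    ; isGroup = record
      { isMonoid = record
        { isSemigroup = record
          { isMagma = record
            { isEquivalence = record { refl = refl ; sym = sym ; trans = trans }
            ; ∙-cong = ∙-cong }
          ; assoc = assoc }
        ; identity = identityˡ , identityʳ }
      ; inverse = inverseˡ , inverseʳ
      ; ⁻¹-cong = ⁻¹-cong }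
    }

data Generator : Set where
  𝒂 𝒃 : Generator

a b : Term Generator
a = gen 𝒂
b = gen 𝒃

data DihedralRelation (n : ℕ) : Rel (Term Generator) 0ℓ where
  aⁿ≈ε : DihedralRelation n (a ^ n) ε
  b²≈ε : DihedralRelation n (b ^ 2) ε
  ba≈  : DihedralRelation n (b ∙ a) (a ^ (n ℕ.∸ 1) ∙ b)

D : ℕ → Group 0ℓ 0ℓ
D n = Presentation.group (DihedralRelation n)

-- D n has order 2n: the pair (j , i) stands for the element aⁱ bʲ, and nf
-- computes normal forms by letting D n act on such pairs by left
-- multiplication.

module Dihedral (n : ℕ) .{{n≢0 : NonZero n}} where
  open Presentation (DihedralRelation n) public

  NF : Set
  NF = Fin 2 × Fin n

  private
    m : ℕ
    m = n ℕ.∸ 1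

    1+m≡n : suc m ≡ n
    1+m≡n = ℕₚ.suc-pred n

  actGen actGen⁻¹ : Generator → NF → NF
  actGen 𝒂 (j , i) = j , suc (toℕ i) mod n
  actGen 𝒃 (j , i) = opposite j , (m ℕ.* toℕ i) mod n
  actGen⁻¹ 𝒂 (j , i) = j , (m ℕ.+ toℕ i) mod n
  actGen⁻¹ 𝒃 = actGen 𝒃

  act act⁻¹ : Term Generator → NF → NF
  act (gen g) = actGen g
  act ε       = id
  act (x ∙ y) = act x ∘ act y
  act (x ⁻¹)  = act⁻¹ x
  act⁻¹ (gen g) = actGen⁻¹ g
  act⁻¹ ε       = id
  act⁻¹ (x ∙ y) = act⁻¹ y ∘ act⁻¹ x
  act⁻¹ (x ⁻¹)  = act x

  nf : Term Generator → NF
  nf x = act x (fzero , 0 mod n)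

  fromNF : NF → Term Generator
  fromNF (j , i) = a ^ toℕ i ∙ b ^ toℕ j

  private
    open ≡.≡-Reasoning

    toℕ-mod : ∀ k → toℕ (k mod n) ≡ k % n
    toℕ-mod k = toℕ-fromℕ< (m%n<n k n)

    mod-cong : ∀ {k l} → k % n ≡ l % n → k mod n ≡ l mod n
    mod-cong {k} {l} eq = toℕ-injective
      (≡.trans (toℕ-mod k) (≡.trans eq (≡.sym (toℕ-mod l))))

    mod-toℕ : ∀ i → toℕ i mod n ≡ i
    mod-toℕ i = toℕ-injective (≡.trans (toℕ-mod (toℕ i)) (m<n⇒m%n≡m (toℕ<n i)))

    mod-+ : ∀ k l → (k ℕ.+ toℕ (l mod n)) mod n ≡ (k ℕ.+ l) mod n
    mod-+ k l = mod-cong $ begin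
      (k ℕ.+ toℕ (l mod n)) % n        ≡⟨ cong (λ t → (k ℕ.+ t) % n) (toℕ-mod l) ⟩
      (k ℕ.+ l % n) % n                ≡⟨ %-distribˡ-+ k (l % n) n ⟩
      (k % n ℕ.+ l % n % n) % n        ≡⟨ cong (λ t → (k % n ℕ.+ t) % n) (m%n%n≡m%n l n) ⟩
      (k % n ℕ.+ l % n) % n            ≡⟨ %-distribˡ-+ k l n ⟨
      (k ℕ.+ l) % n                    ∎

    mod-* : ∀ k l → (k ℕ.* toℕ (l mod n)) mod n ≡ (k ℕ.* l) mod n
    mod-* k l = mod-cong $ begin
      (k ℕ.* toℕ (l mod n)) % n        ≡⟨ cong (λ t → (k ℕ.* t) % n) (toℕ-mod l) ⟩
      (k ℕ.* (l % n)) % n              ≡⟨ %-distribˡ-* k (l % n) n ⟩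
      ((k % n) ℕ.* (l % n % n)) % n    ≡⟨ cong (λ t → ((k % n) ℕ.* t) % n) (m%n%n≡m%n l n) ⟩
      ((k % n) ℕ.* (l % n)) % n        ≡⟨ %-distribˡ-* k l n ⟨
      (k ℕ.* l) % n                    ∎

    mod-n+ : ∀ i → (n ℕ.+ toℕ i) mod n ≡ i
    mod-n+ i = ≡.trans (mod-cong ([m+n]%n≡m%n′)) (mod-toℕ i)
      where
      [m+n]%n≡m%n′ : (n ℕ.+ toℕ i) % n ≡ toℕ i % n
      [m+n]%n≡m%n′ = ≡.trans (cong (_% n) (ℕₚ.+-comm n (toℕ i))) ([m+n]%n≡m%n (toℕ i) n)

    square : ∀ k .{{_ : NonZero k}} i → ((k ℕ.∸ 1) ℕ.* ((k ℕ.∸ 1) ℕ.* i)) % k ≡ i % k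
    square 1 i = ≡.sym (n%1≡0 i)
    square (suc (suc k)) i = ≡.trans
      (cong (_% suc (suc k)) (expand k i)) ([m+kn]%n≡m%n i (k ℕ.* i) (suc (suc k)))
      where
      expand : ∀ k i → suc k ℕ.* (suc k ℕ.* i) ≡ i ℕ.+ (k ℕ.* i) ℕ.* suc (suc k)
      expand = solve-∀

    aa⁻¹ : ∀ x → actGen 𝒂 (actGen⁻¹ 𝒂 x) ≡ x
    aa⁻¹ (j , i) = cong (j ,_) $ begin
      suc (toℕ ((m ℕ.+ toℕ i) mod n)) mod n  ≡⟨ mod-+ 1 (m ℕ.+ toℕ i) ⟩
      (suc m ℕ.+ toℕ i) mod n                ≡⟨ cong (λ t → (t ℕ.+ toℕ i) mod n) 1+m≡n ⟩
      (n ℕ.+ toℕ i) mod n                    ≡⟨ mod-n+ i ⟩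
      i                                      ∎

    a⁻¹a : ∀ x → actGen⁻¹ 𝒂 (actGen 𝒂 x) ≡ x
    a⁻¹a (j , i) = cong (j ,_) $ begin
      (m ℕ.+ toℕ (suc (toℕ i) mod n)) mod n  ≡⟨ mod-+ m (suc (toℕ i)) ⟩
      (m ℕ.+ suc (toℕ i)) mod n              ≡⟨ cong (_mod n) (ℕₚ.+-suc m (toℕ i)) ⟩
      (suc m ℕ.+ toℕ i) mod n                ≡⟨ cong (λ t → (t ℕ.+ toℕ i) mod n) 1+m≡n ⟩
      (n ℕ.+ toℕ i) mod n                    ≡⟨ mod-n+ i ⟩
      i                                      ∎

    bb : ∀ x → actGen 𝒃 (actGen 𝒃 x) ≡ x
    bb (j , i) = cong₂ _,_ (opposite-involutive j) $ begin
      (m ℕ.* toℕ ((m ℕ.* toℕ i) mod n)) mod n  ≡⟨ mod-* m (m ℕ.* toℕ i) ⟩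
      (m ℕ.* (m ℕ.* toℕ i)) mod n              ≡⟨ mod-cong (square n (toℕ i)) ⟩
      toℕ i mod n                              ≡⟨ mod-toℕ i ⟩
      i                                        ∎

    act-inverseʳ : ∀ w x → act w (act⁻¹ w x) ≡ x
    act-inverseˡ : ∀ w x → act⁻¹ w (act w x) ≡ x
    act-inverseʳ (gen 𝒂) x = aa⁻¹ x
    act-inverseʳ (gen 𝒃) x = bb x
    act-inverseʳ ε       x = ≡.refl
    act-inverseʳ (u ∙ w) x = ≡.trans (cong (act u) (act-inverseʳ w _)) (act-inverseʳ u x)
    act-inverseʳ (w ⁻¹)  x = act-inverseˡ w x
    act-inverseˡ (gen 𝒂) x = a⁻¹a x
    act-inverseˡ (gen 𝒃) x = bb x
    act-inverseˡ ε       x = ≡.refl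
    act-inverseˡ (u ∙ w) x = ≡.trans (cong (act⁻¹ w) (act-inverseˡ u _)) (act-inverseˡ w x)
    act-inverseˡ (w ⁻¹)  x = act-inverseʳ w x

    act-a^ : ∀ k j i → act (a ^ k) (j , i) ≡ (j , (k ℕ.+ toℕ i) mod n)
    act-a^ zero    j i = cong (j ,_) (≡.sym (mod-toℕ i))
    act-a^ (suc k) j i = ≡.trans (cong (actGen 𝒂) (act-a^ k j i))
                                 (cong (j ,_) (mod-+ 1 (k ℕ.+ toℕ i)))

    act-relation : ∀ {u w} → DihedralRelation n u w → ∀ x → act u x ≡ act w x
    act-relation aⁿ≈ε (j , i) = ≡.trans (act-a^ n j i) (cong (j ,_) (mod-n+ i))
    act-relation b²≈ε x       = bb x
    act-relation ba≈  (j , i) = ≡.sym $ begin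
      act (a ^ m) (actGen 𝒃 (j , i))
        ≡⟨ act-a^ m (opposite j) _ ⟩
      (opposite j , (m ℕ.+ toℕ ((m ℕ.* toℕ i) mod n)) mod n)
        ≡⟨ cong (opposite j ,_) (mod-+ m (m ℕ.* toℕ i)) ⟩
      (opposite j , (m ℕ.+ m ℕ.* toℕ i) mod n)
        ≡⟨ cong (λ t → opposite j , t mod n) (ℕₚ.*-suc m (toℕ i)) ⟨
      (opposite j , (m ℕ.* suc (toℕ i)) mod n)
        ≡⟨ cong (opposite j ,_) (mod-* m (suc (toℕ i))) ⟨
      actGen 𝒃 (actGen 𝒂 (j , i))
        ∎

  act-cong : ∀ {u w} → u ~ w → ∀ x → act u x ≡ act w x
  act-cong (relation r)    x = act-relation r x
  act-cong refl            x = ≡.refl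
  act-cong (sym p)         x = ≡.sym (act-cong p x)
  act-cong (trans p q)     x = ≡.trans (act-cong p x) (act-cong q x)
  act-cong (∙-cong {u} {u′} {w} {w′} p q) x =
    ≡.trans (cong (act u) (act-cong q x)) (act-cong p (act w′ x))
  act-cong (⁻¹-cong {u} {w} p) x = begin
    act⁻¹ u x                        ≡⟨ cong (act⁻¹ u) (act-inverseʳ w x) ⟨
    act⁻¹ u (act w (act⁻¹ w x))      ≡⟨ cong (act⁻¹ u) (act-cong p (act⁻¹ w x)) ⟨
    act⁻¹ u (act u (act⁻¹ w x))      ≡⟨ act-inverseˡ u _ ⟩
    act⁻¹ w x                        ∎
  act-cong (assoc _ _ _)   x = ≡.refl
  act-cong (identityˡ _)   x = ≡.refl
  act-cong (identityʳ _)   x = ≡.refl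
  act-cong (inverseˡ w)    x = act-inverseˡ w x
  act-cong (inverseʳ w)    x = act-inverseʳ w x

  private
    open SetoidReasoning (Group.setoid (D n)) using (step-≈-⟩; step-≈-⟨)
      renaming (begin_ to begin~_; _∎ to _∎~)

    ∙-congˡ : ∀ {u w w′} → w ~ w′ → u ∙ w ~ u ∙ w′
    ∙-congˡ = ∙-cong refl

    ∙-congʳ : ∀ {u u′ w} → u ~ u′ → u ∙ w ~ u′ ∙ w
    ∙-congʳ p = ∙-cong p refl

    ≡⇒~ : ∀ {u w} → u ≡ w → u ~ w
    ≡⇒~ ≡.refl = refl

    ^-+ : ∀ (u : Term Generator) k l → u ^ (k ℕ.+ l) ~ u ^ k ∙ u ^ l
    ^-+ u zero    l = sym (identityˡ _)
    ^-+ u (suc k) l = trans (∙-congˡ (^-+ u k l)) (sym (assoc _ _ _))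

    a^[kn] : ∀ k → a ^ (k ℕ.* n) ~ ε
    a^[kn] zero    = refl
    a^[kn] (suc k) = trans (^-+ a n (k ℕ.* n))
      (trans (∙-cong (relation aⁿ≈ε) (a^[kn] k)) (identityˡ ε))

    a^-mod : ∀ k → a ^ toℕ (k mod n) ~ a ^ k
    a^-mod k = begin~
      a ^ toℕ (k mod n)                      ≈⟨ ≡⇒~ (cong (a ^_) (toℕ-mod k)) ⟩
      a ^ (k % n)                            ≈⟨ identityʳ _ ⟨
      a ^ (k % n) ∙ ε                        ≈⟨ ∙-congˡ (a^[kn] (k / n)) ⟨
      a ^ (k % n) ∙ a ^ (k / n ℕ.* n)        ≈⟨ ^-+ a (k % n) (k / n ℕ.* n) ⟨
      a ^ (k % n ℕ.+ k / n ℕ.* n)            ≈⟨ ≡⇒~ (cong (a ^_) (m≡m%n+[m/n]*n k n)) ⟨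
      a ^ k                                  ∎~

    b∙a^ : ∀ k → b ∙ a ^ k ~ a ^ (m ℕ.* k) ∙ b
    b∙a^ zero = trans (identityʳ b) (trans (sym (identityˡ b))
      (∙-congʳ (≡⇒~ (cong (a ^_) (≡.sym (ℕₚ.*-zeroʳ m))))))
    b∙a^ (suc k) = begin~
      b ∙ (a ∙ a ^ k)                        ≈⟨ assoc _ _ _ ⟨
      (b ∙ a) ∙ a ^ k                        ≈⟨ ∙-congʳ (relation ba≈) ⟩
      (a ^ m ∙ b) ∙ a ^ k                    ≈⟨ assoc _ _ _ ⟩
      a ^ m ∙ (b ∙ a ^ k)                    ≈⟨ ∙-congˡ (b∙a^ k) ⟩
      a ^ m ∙ (a ^ (m ℕ.* k) ∙ b)            ≈⟨ assoc _ _ _ ⟨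
      (a ^ m ∙ a ^ (m ℕ.* k)) ∙ b            ≈⟨ ∙-congʳ (^-+ a m (m ℕ.* k)) ⟨
      a ^ (m ℕ.+ m ℕ.* k) ∙ b                ≈⟨ ∙-congʳ (≡⇒~ (cong (a ^_) (≡.sym (ℕₚ.*-suc m k)))) ⟩
      a ^ (m ℕ.* suc k) ∙ b                  ∎~

    b^-opposite : ∀ (j : Fin 2) → b ^ toℕ (opposite j) ~ b ∙ b ^ toℕ j
    b^-opposite fzero        = refl
    b^-opposite (fsuc fzero) = sym (relation b²≈ε)

  fromNF-act : ∀ w x → fromNF (act w x) ~ w ∙ fromNF x
  private
    fromNF-act⁻¹ : ∀ w x → fromNF (act⁻¹ w x) ~ w ⁻¹ ∙ fromNF x
    fromNF-act⁻¹ w x = begin~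
      fromNF y                               ≈⟨ identityˡ _ ⟨
      ε ∙ fromNF y                           ≈⟨ ∙-congʳ (inverseˡ w) ⟨
      (w ⁻¹ ∙ w) ∙ fromNF y                  ≈⟨ assoc _ _ _ ⟩
      w ⁻¹ ∙ (w ∙ fromNF y)                  ≈⟨ ∙-congˡ (fromNF-act w y) ⟨
      w ⁻¹ ∙ fromNF (act w y)                ≈⟨ ∙-congˡ (≡⇒~ (cong fromNF (act-inverseʳ w x))) ⟩
      w ⁻¹ ∙ fromNF x                        ∎~
      where y = act⁻¹ w x
  fromNF-act (gen 𝒂) (j , i) = trans (∙-congʳ (a^-mod (suc (toℕ i)))) (assoc _ _ _)
  fromNF-act (gen 𝒃) (j , i) = begin~
    a ^ toℕ ((m ℕ.* toℕ i) mod n) ∙ b ^ toℕ (opposite j)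
      ≈⟨ ∙-cong (a^-mod (m ℕ.* toℕ i)) (b^-opposite j) ⟩
    a ^ (m ℕ.* toℕ i) ∙ (b ∙ b ^ toℕ j)      ≈⟨ assoc _ _ _ ⟨
    (a ^ (m ℕ.* toℕ i) ∙ b) ∙ b ^ toℕ j      ≈⟨ ∙-congʳ (b∙a^ (toℕ i)) ⟨
    (b ∙ a ^ toℕ i) ∙ b ^ toℕ j              ≈⟨ assoc _ _ _ ⟩
    b ∙ (a ^ toℕ i ∙ b ^ toℕ j)              ∎~
  fromNF-act ε       x = sym (identityˡ _)
  fromNF-act (u ∙ w) x = trans (fromNF-act u (act w x))
    (trans (∙-congˡ (fromNF-act w x)) (sym (assoc _ _ _)))
  fromNF-act (w ⁻¹)  x = fromNF-act⁻¹ w x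

  fromNF-nf : ∀ w → fromNF (nf w) ~ w
  fromNF-nf w = trans (fromNF-act w _)
    (trans (∙-congˡ (trans (identityʳ _) (a^-mod 0))) (identityʳ w))

  nf-fromNF : ∀ x → nf (fromNF x) ≡ x
  nf-fromNF (j , i) = begin
    act (a ^ toℕ i) (act (b ^ toℕ j) (fzero , 0 mod n))
      ≡⟨ cong (act (a ^ toℕ i)) (nf-b^ j) ⟩
    act (a ^ toℕ i) (j , 0 mod n)
      ≡⟨ act-a^ (toℕ i) j (0 mod n) ⟩
    (j , (toℕ i ℕ.+ toℕ (0 mod n)) mod n)
      ≡⟨ cong (j ,_) (mod-+ (toℕ i) 0) ⟩
    (j , (toℕ i ℕ.+ 0) mod n)
      ≡⟨ cong (λ t → j , t mod n) (ℕₚ.+-identityʳ (toℕ i)) ⟩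
    (j , toℕ i mod n)
      ≡⟨ cong (j ,_) (mod-toℕ i) ⟩
    (j , i)
      ∎
    where
    nf-b^ : ∀ (j : Fin 2) → act (b ^ toℕ j) (fzero , 0 mod n) ≡ (j , 0 mod n)
    nf-b^ fzero        = ≡.refl
    nf-b^ (fsuc fzero) = cong (fsuc fzero ,_)
      (≡.trans (mod-* m 0) (cong (_mod n) (ℕₚ.*-zeroʳ m)))

  NF↔D : Inverse (≡.setoid NF) (Group.setoid (D n))
  NF↔D = record
    { to        = fromNF
    ; from      = nf
    ; to-cong   = λ eq → ≡⇒~ (cong fromNF eq)
    ; from-cong = λ p → act-cong p _
    ; inverse   = (λ {w} eq → trans (≡⇒~ (cong fromNF eq)) (fromNF-nf w))
                , (λ {x} p → ≡.trans (act-cong p _) (nf-fromNF x))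
    }

  enumeration : Inverse (≡.setoid (Fin (2 ℕ.* n))) (Group.setoid (D n))
  enumeration = Compose.inverse (*↔× {2} {n}) NF↔D

  b≉ε : ¬ (b ~ ε)
  b≉ε p with cong proj₁ (act-cong p (fzero , 0 mod n))
  ... | ()

  a≉ε : 2 ℕ.≤ n → ¬ (a ~ ε)
  a≉ε 2≤n p with begin
      1                                    ≡⟨ m<n⇒m%n≡m 2≤n ⟨
      1 % n                                ≡⟨ toℕ-mod 1 ⟨
      toℕ (1 mod n)                        ≡⟨ cong toℕ (mod-+ 1 0) ⟨
      toℕ (suc (toℕ (0 mod n)) mod n)      ≡⟨ cong (toℕ ∘ proj₂) (act-cong p (fzero , 0 mod n)) ⟩
      toℕ (0 mod n)                        ≡⟨ toℕ-mod 0 ⟩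
      0 % n                                ≡⟨ m<n⇒m%n≡m (≤-trans (n≤1+n 1) 2≤n) ⟩
      0                                    ∎
  ... | ()

module _ (n : ℕ) (3≤n : 3 ℕ.≤ n) where
  private
    instance
      n≢0 : NonZero n
      n≢0 = ℕ.>-nonZero (≤-trans (ℕ.s≤s ℕ.z≤n) 3≤n)

  open Dihedral n

  a≉e : ¬ (a ~ ε)
  a≉e = a≉ε (≤-trans (n≤1+n 2) 3≤n)

  e≉a : ¬ (ε ~ a)
  e≉a = a≉e ∘ sym

  e≉b : ¬ (ε ~ b)
  e≉b = b≉ε ∘ sym

  dihedralCayleyGraph : FiniteDigraph 0ℓ 0ℓ 0ℓ
  dihedralCayleyGraph =
    CayleyGraph (D n) enumeration (a ∷ b ∷ []) (a≉e ∷ b≉ε ∷ [])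

{-# OPTIONS --safe #-}
module Submission where

-- Near α = 1 an optimal transport plan for the lazy walks at the ends of an arc is explicit: it
-- moves four point masses.  Its optimality is certified by Kantorovich duality, with a potential
-- that rises by at most one along each arc and by exactly the distance along each transported
-- mass; such a potential also computes the few distances needed.  The curvature then depends only
-- on the word length of b a², which is 2 for n = 3 (b a² = a b) and 3 for n ≥ 4: this is d(b, a²)
-- for the arc (e , a) and d(a, b a) for the arc (e , b).

open import Defs
open import Level using (_⊔_)
open import Algebra.Apartness.Bundles using (HeytingCommutativeRing)
open import Algebra.Bundles using (CommutativeRing; Group)
open import Data.Bool.Base using (if_then_else_)
open import Data.Empty using (⊥-elim)
open import Data.Fin.Base using (Fin; toℕ; fromℕ<) renaming (zero to fzero; suc to fsuc)
open import Data.Fin.Properties using (any?; fromℕ<-injective; toℕ-fromℕ<)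
open import Data.List.Base using (List; []; _∷_; allFin)
open import Data.List.Membership.Propositional using (_∈_)
open import Data.List.Membership.Propositional.Properties using (∈-allFin; ∈-filter⁺; ∈-filter⁻)
open import Data.List.Membership.Propositional.Properties.WithK using (unique∧set⇒bag)
open import Data.List.Relation.Binary.BagAndSetEquality using (∼bag⇒↭)
open import Data.List.Relation.Binary.Permutation.Propositional.Properties using (↭-length)
open import Data.List.Relation.Unary.All as All using (All; []; _∷_)
open import Data.List.Relation.Unary.All.Properties using (All¬⇒¬Any)
open import Data.List.Relation.Unary.AllPairs using ([]; _∷_)
open import Data.List.Relation.Unary.Any as Any using (Any; here; there)
open import Data.Nat.Base as ℕ using (ℕ; zero; suc)
open import Data.Nat.DivMod using (_mod_)
open import Data.Nat.Properties as ℕₚ using (m∸n+n≡m)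
open import Data.Product.Base using (_×_; _,_; proj₁; proj₂; ∃-syntax)
open import Data.Sum.Base using (_⊎_; inj₁; inj₂)
open import Function.Base using (_∘_)
open import Function.Bundles using (Inverse; mk⇔)
open import Relation.Binary.PropositionalEquality as ≡ using (_≡_; _≢_)
open import Relation.Nullary using (Dec; yes; no; ¬_; does)
open import Relation.Nullary.Decidable using (map′; _×-dec_)
import Data.List.Relation.Unary.Unique.Propositional.Properties as Unique
import Algebra.Properties.Group as GroupProperties
import Algebra.Properties.Semiring.Mult as SemiringMult
import Algebra.Properties.Semiring.Sum as SemiringSum
import Algebra.Solver.Ring.NaturalCoefficients.Default as SemiringSolver
import Relation.Binary.Reasoning.Setoid as SetoidReasoning

-- Let q = (1 - α)/2 be the mass of each out-neighbour and k the word length of b a². Since α + 2q =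
-- 1, the mass `rest` = α - q equals 1 - 3q. Along (e , a) the plan costs rest + 2q + kq = 1 + (k -
-- 1)q. Along (e , b) the relation b² = e gives a 2-cycle, hence more common mass, and the cost is
-- rest + kq = 1 + (k - 3)q. So W is exactly affine in α near 1, the quotient under the limit is
-- constant, and κ is (1 - k)/2 or (3 - k)/2. Both arcs see the same k because b⁻¹ a² = b a² = a⁻¹
-- (b a). The obstacle is that n is arbitrary and vertices are words modulo a congruence, so neither
-- distances nor membership tests compute. A potential is therefore given by two or three explicit
-- layers near the plan, with all other vertices at one common top height. Checking it takes only
-- the products of the listed vertices with a and b; evaluating it takes only the distinctness of
-- some aⁱ and aⁱ b, which is where n = 3 and n ≥ 4 part.

module RealProperties {c ℓ₁ ℓ₂} (ℝ : RealNumbers c ℓ₁ ℓ₂) where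
  open RealNumbers ℝ

  commutativeRing : CommutativeRing c ℓ₁
  commutativeRing = HeytingCommutativeRing.commutativeRing heytingCommutativeRing

  open CommutativeRing commutativeRing public using (semiring; commutativeSemiring)
  open SetoidReasoning setoid

  -- Order and arithmetic in the axiomatic ℝ

  <-respʳ : ∀ {x y z} → y ≈ z → x < y → x < z
  <-respʳ = proj₁ <-resp-≈

  <-respˡ : ∀ {x y z} → y ≈ z → y < x → z < x
  <-respˡ = proj₂ <-resp-≈

  <-resp : ∀ {x x′ y y′} → x ≈ x′ → y ≈ y′ → x < y → x′ < y′
  <-resp p q = <-respˡ p ∘ <-respʳ q

  -- Cotransitivity of apartness supplies the cases; an apartness oriented the wrong way still
  -- decides the question by transitivity through x < y.
  <-cotrans : ∀ {x y} → x < y → ∀ z → x < z ⊎ z < y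
  <-cotrans x<y z with #-cotrans (<⇒# x<y) z
  ... | inj₁ x#z with #⇒<⊎> x#z
  ...   | inj₁ x<z = inj₁ x<z
  ...   | inj₂ z<x = inj₂ (<-trans z<x x<y)
  <-cotrans x<y z | inj₂ z#y with #⇒<⊎> z#y
  ...   | inj₁ z<y = inj₂ z<y
  ...   | inj₂ y<z = inj₁ (<-trans x<y y<z)

  ≤-reflexive : ∀ {x y} → x ≈ y → x ≤ y
  ≤-reflexive x≈y = <-irrefl (sym x≈y)

  <⇒≤ : ∀ {x y} → x < y → x ≤ y
  <⇒≤ x<y y<x = <-irrefl refl (<-trans x<y y<x)

  -- As `≤` is a negated strict order, cotransitivity is needed: a counterexample z < x would force
  -- z < y or y < x.
  ≤-trans : ∀ {x y z} → x ≤ y → y ≤ z → x ≤ z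
  ≤-trans {y = y} x≤y y≤z z<x with <-cotrans z<x y
  ... | inj₁ z<y = y≤z z<y
  ... | inj₂ y<x = x≤y y<x

  ≤-resp : ∀ {x x′ y y′} → x ≈ x′ → y ≈ y′ → x ≤ y → x′ ≤ y′
  ≤-resp p q x≤y = x≤y ∘ <-resp (sym q) (sym p)

  -x+[x+y]≈y : ∀ x y → - x + (x + y) ≈ y
  -x+[x+y]≈y x y = begin
    - x + (x + y)  ≈⟨ +-assoc (- x) x y ⟨
    - x + x + y    ≈⟨ +-congʳ (-‿inverseˡ x) ⟩
    0# + y         ≈⟨ +-identityˡ y ⟩
    y              ∎

  +-monoʳ-≤ : ∀ z {x y} → x ≤ y → z + x ≤ z + y
  +-monoʳ-≤ z {x} {y} x≤y z+y<z+x =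
    x≤y (<-resp (-x+[x+y]≈y z y) (-x+[x+y]≈y z x) (+-monoʳ-< (- z) z+y<z+x))

  +-mono-≤ : ∀ {x x′ y y′} → x ≤ x′ → y ≤ y′ → x + y ≤ x′ + y′
  +-mono-≤ {x} {x′} {y} {y′} x≤x′ y≤y′ =
    ≤-trans (≤-resp (+-comm y x) (+-comm y x′) (+-monoʳ-≤ y x≤x′)) (+-monoʳ-≤ x′ y≤y′)

  +-cancelʳ-≤ : ∀ z {x y} → x + z ≤ y + z → x ≤ y
  +-cancelʳ-≤ z {x} {y} x+z≤y+z y<x =
    x+z≤y+z (<-resp (+-comm z y) (+-comm z x) (+-monoʳ-< z y<x))

  x<x+ε : ∀ {x ε} → 0# < ε → x < x + ε
  x<x+ε {x} 0<ε = <-respˡ (+-identityʳ x) (+-monoʳ-< x 0<ε)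

  0≤x+y : ∀ {x y} → 0# ≤ x → 0# ≤ y → 0# ≤ x + y
  0≤x+y 0≤x 0≤y = ≤-resp (+-identityˡ 0#) refl (+-mono-≤ 0≤x 0≤y)

  fromℕ-homo-+ : ∀ k l → fromℕ (k ℕ.+ l) ≈ fromℕ k + fromℕ l
  fromℕ-homo-+ = SemiringMult.×-homo-+ semiring 1#

  -- By repeated addition, as `*-positive` covers only strict inequalities. Natural multiples are
  -- all that duality needs, since distances and heights are natural numbers.
  0≤x*fromℕ : ∀ {x} → 0# ≤ x → ∀ k → 0# ≤ x * fromℕ k
  0≤x*fromℕ {x} 0≤x zero    = ≤-reflexive (sym (zeroʳ x))
  0≤x*fromℕ {x} 0≤x (suc k) = ≤-resp refl
    (sym (trans (distribˡ x 1# (fromℕ k)) (+-congʳ (*-identityʳ x))))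
    (0≤x+y 0≤x (0≤x*fromℕ 0≤x k))

  *fromℕ-mono-≤ : ∀ {x k l} → 0# ≤ x → k ℕ.≤ l → x * fromℕ k ≤ x * fromℕ l
  *fromℕ-mono-≤ {x} {k} {l} 0≤x k≤l = ≤-resp (+-identityˡ _) eq
    (+-mono-≤ (0≤x*fromℕ 0≤x (l ℕ.∸ k)) (≤-reflexive refl))
    where
    eq : x * fromℕ (l ℕ.∸ k) + x * fromℕ k ≈ x * fromℕ l
    eq = begin
      x * fromℕ (l ℕ.∸ k) + x * fromℕ k    ≈⟨ distribˡ x _ _ ⟨
      x * (fromℕ (l ℕ.∸ k) + fromℕ k)      ≈⟨ *-congˡ (fromℕ-homo-+ (l ℕ.∸ k) k) ⟨
      x * fromℕ (l ℕ.∸ k ℕ.+ k)            ≡⟨ ≡.cong (λ j → x * fromℕ j) (m∸n+n≡m k≤l) ⟩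
      x * fromℕ l                          ∎

  open SemiringSum semiring public
    using (sum-cong-≋; sum-replicate-zero; ∑-distrib-+; ∑-comm; *-distribˡ-sum)

  sum-mono-≤ : ∀ {n} {s t : Fin n → Carrier} → (∀ i → s i ≤ t i) → sum s ≤ sum t
  sum-mono-≤ {zero}  s≤t = ≤-reflexive refl
  sum-mono-≤ {suc n} s≤t = +-mono-≤ (s≤t fzero) (sum-mono-≤ (s≤t ∘ fsuc))

  sum-single : ∀ {n} (t : Fin n → Carrier) i → (∀ j → j ≢ i → t j ≈ 0#) → sum t ≈ t i
  sum-single {suc n} t fzero    t≈0 =
    trans (+-congˡ (trans (sum-cong-≋ (λ j → t≈0 (fsuc j) λ ())) (sum-replicate-zero n)))
          (+-identityʳ _)
  sum-single {suc n} t (fsuc i) t≈0 =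
    trans (+-cong (t≈0 fzero λ ())
                  (sum-single (t ∘ fsuc) i λ j j≢i → t≈0 (fsuc j) λ { ≡.refl → j≢i ≡.refl }))
          (+-identityˡ _)

  x-0≈x : ∀ x → x - 0# ≈ x
  x-0≈x x = trans (sym (+-identityˡ (x - 0#))) (trans (+-comm _ _) (trans (+-assoc _ _ _)
    (trans (+-congˡ (-‿inverseˡ 0#)) (+-identityʳ x))))

  x-y+y≈x : ∀ x y → x - y + y ≈ x
  x-y+y≈x x y = trans (+-assoc _ _ _) (trans (+-congˡ (-‿inverseˡ y)) (+-identityʳ x))

  x+y≈z⇒x≈z-y : ∀ {x y z} → x + y ≈ z → x ≈ z - y
  x+y≈z⇒x≈z-y {x} {y} {z} x+y≈z = begin
    x              ≈⟨ +-identityʳ x ⟨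
    x + 0#         ≈⟨ +-congˡ (-‿inverseʳ y) ⟨
    x + (y - y)    ≈⟨ +-assoc x y (- y) ⟨
    x + y - y      ≈⟨ +-congʳ x+y≈z ⟩
    z - y          ∎

  x≈y⇒x-y<ε : ∀ {x y ε} → x ≈ y → 0# < ε → x - y < ε
  x≈y⇒x-y<ε {y = y} x≈y = <-respˡ (sym (trans (+-congʳ x≈y) (-‿inverseʳ y)))

  quotient-cancel : ∀ {x y z} t (y#z : y # z) → t ≈ (y - z) * x → quotient t y#z ≈ x
  quotient-cancel {x} {y} {z} t y#z t≈[y-z]x = begin
    t * i              ≈⟨ *-congʳ t≈[y-z]x ⟩
    (y - z) * x * i    ≈⟨ *-congʳ (*-comm (y - z) x) ⟩
    x * (y - z) * i    ≈⟨ *-assoc x (y - z) i ⟩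
    x * ((y - z) * i)  ≈⟨ *-congˡ (proj₂ (proj₂ (#⇒invertible y#z))) ⟩
    x * 1#             ≈⟨ *-identityʳ x ⟩
    x                  ∎
    where i = proj₁ (#⇒invertible y#z)

  /ℕ1 : ∀ x → x /ℕ 1 ≈ x
  /ℕ1 x = quotient-cancel x (fromℕ#0 1)
    (sym (trans (*-congʳ (trans (x-0≈x _) (+-identityʳ 1#))) (*-identityˡ x)))

  ½+½≈1 : ½ + ½ ≈ 1#
  ½+½≈1 = begin
    ½ + ½                ≈⟨ +-cong (*-identityʳ ½) (*-identityʳ ½) ⟨
    ½ * 1# + ½ * 1#      ≈⟨ distribˡ ½ 1# 1# ⟨
    ½ * (1# + 1#)        ≈⟨ *-congˡ (+-congˡ (+-identityʳ 1#)) ⟨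
    ½ * fromℕ 2          ≈⟨ *-congʳ (*-identityˡ h) ⟩
    h * fromℕ 2          ≈⟨ *-congˡ (x-0≈x _) ⟨
    h * (fromℕ 2 - 0#)   ≈⟨ proj₁ (proj₂ (#⇒invertible (fromℕ#0 2))) ⟩
    1#                   ∎
    where h = proj₁ (#⇒invertible (fromℕ#0 2))

  x/ℕ2≈x*½ : ∀ x → x /ℕ 2 ≈ x * ½
  x/ℕ2≈x*½ x = *-congˡ (sym (*-identityˡ _))

  x*½+x*½≈x : ∀ x → x * ½ + x * ½ ≈ x
  x*½+x*½≈x x = trans (sym (distribˡ x ½ ½)) (trans (*-congˡ ½+½≈1) (*-identityʳ x))

  /ℕ-congʳ : ∀ x {k l} .{{_ : ℕ.NonZero k}} .{{_ : ℕ.NonZero l}} → k ≡ l → x /ℕ k ≈ x /ℕ l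
  /ℕ-congʳ x ≡.refl = refl

  +-cancelˡ-< : ∀ z {x y} → z + x < z + y → x < y
  +-cancelˡ-< z {x} {y} = <-resp (-x+[x+y]≈y z x) (-x+[x+y]≈y z y) ∘ +-monoʳ-< (- z)

  x<y⇒0<y-x : ∀ {x y} → x < y → 0# < y - x
  x<y⇒0<y-x {x} {y} = <-resp (-‿inverseˡ x) (+-comm (- x) y) ∘ +-monoʳ-< (- x)

  -- Cotransitivity of 0 < 1 at ½ leaves the case ½ < 1 = ½ + ½, where cancelling ½ gives the claim
  -- as well.
  0<½ : 0# < ½
  0<½ with <-cotrans 0<1 ½
  ... | inj₁ 0<½ = 0<½
  ... | inj₂ ½<1 = +-cancelˡ-< ½ (<-resp (sym (+-identityʳ ½)) (sym ½+½≈1) ½<1)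

  x*2≈x+x : ∀ x → x * fromℕ 2 ≈ x + x
  x*2≈x+x = solve 1 (λ x → x :* (con 1 :+ (con 1 :+ con 0)) := x :+ x) refl
    where open SemiringSolver commutativeSemiring

  x*3≈x+[x+x] : ∀ x → x * fromℕ 3 ≈ x + (x + x)
  x*3≈x+[x+x] = solve 1 (λ x → x :* (con 1 :+ (con 1 :+ (con 1 :+ con 0))) := x :+ (x :+ x)) refl
    where open SemiringSolver commutativeSemiring

  -- This and `-1+½*3≈½` are the relation κ + k/2 = 1/2 of the arc (e , a), at k = 2 and at k = 3.
  -½+½*2≈½ : - ½ + ½ * fromℕ 2 ≈ ½
  -½+½*2≈½ = trans (+-congˡ (x*2≈x+x ½)) (-x+[x+y]≈y ½ ½)

  -1+½*3≈½ : - 1# + ½ * fromℕ 3 ≈ ½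
  -1+½*3≈½ = trans
    (+-congˡ (trans (x*3≈x+[x+x] ½) (trans (sym (+-assoc ½ ½ ½)) (+-congʳ ½+½≈1))))
    (-x+[x+y]≈y 1# ½)

-- Directed graphs: distance, potentials and layers

least : ∀ {p} {P : ℕ → Set p} → (∀ n → Dec (P n)) → ∀ n → P n →
        ∃[ m ] P m × (∀ {k} → P k → m ℕ.≤ k)
least P? n pn with P? 0
... | yes p0 = 0 , p0 , λ _ → ℕ.z≤n
least P? zero    pn | no ¬p0 = ⊥-elim (¬p0 pn)
least {P = P} P? (suc n) pn | no ¬p0 with least (P? ∘ suc) n pn
... | m , pm , m-least = suc m , pm , λ {k} → bound k
  where
  bound : ∀ k → P k → suc m ℕ.≤ k
  bound zero    p0 = ⊥-elim (¬p0 p0)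
  bound (suc k) pk = ℕ.s≤s (m-least pk)

module DigraphProperties {v ℓ r} (Γ : FiniteDigraph v ℓ r) where
  open FiniteDigraph Γ

  vertex-index : ∀ x → vertex (index x) ≈ x
  vertex-index x = Inverse.inverseˡ enum ≡.refl

  Walk-respˡ : ∀ {x x′ y n} → x ≈ x′ → Walk x y n → Walk x′ y n
  Walk-respˡ x≈x′ (stop x≈y)   = stop (trans (sym x≈x′) x≈y)
  Walk-respˡ x≈x′ (step arc w) = step (proj₂ resp x≈x′ arc) w

  Walk-respʳ : ∀ {x y y′ n} → y ≈ y′ → Walk x y n → Walk x y′ n
  Walk-respʳ y≈y′ (stop x≈y)   = stop (trans x≈y y≈y′)
  Walk-respʳ y≈y′ (step arc w) = step arc (Walk-respʳ y≈y′ w)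

  Walk-resp : ∀ {x x′ y y′ n} → x ≈ x′ → y ≈ y′ → Walk x y n → Walk x′ y′ n
  Walk-resp x≈x′ y≈y′ = Walk-respˡ x≈x′ ∘ Walk-respʳ y≈y′

  Walk? : ∀ x y n → Dec (Walk x y n)
  Walk? x y zero    = map′ stop (λ { (stop x≈y) → x≈y }) (x ≟ y)
  Walk? x y (suc n) = map′
    (λ { (_ , arc , w) → step arc w })
    (λ { (step arc w) → _ , proj₁ resp (sym (vertex-index _)) arc
                          , Walk-respˡ (sym (vertex-index _)) w })
    (any? λ i → Arc? x (vertex i) ×-dec Walk? (vertex i) y n)

  -- Existence of a walk of given length is decidable because intermediate vertices can be
  -- enumerated, so any walk bounds a search for a shortest one.
  distance : (∀ x y → ∃[ n ] Walk x y n) → ∃[ d ] IsDistance d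
  distance connected =
    (λ x y → proj₁ (shortest x y)) , λ x y → proj₂ (shortest x y)
    where
    shortest : ∀ x y → ∃[ m ] Walk x y m × (∀ {k} → Walk x y k → m ℕ.≤ k)
    shortest x y = least (Walk? x y) _ (proj₂ (connected x y))

  record Potential : Set (v ⊔ ℓ ⊔ r) where
    field
      height : Vertex → ℕ
      cong   : ∀ {x y} → x ≈ y → height x ≡ height y
      climb  : ∀ {x y} → Arc x y → height y ℕ.≤ suc (height x)

    climb-walk : ∀ {x y k} → Walk x y k → height y ℕ.≤ k ℕ.+ height x
    climb-walk (stop x≈y) = ℕₚ.≤-reflexive (≡.sym (cong x≈y))
    climb-walk {x} (step {n = k} arc w) = ℕₚ.≤-trans (climb-walk w)
      (ℕₚ.≤-trans (ℕₚ.+-monoʳ-≤ k (climb arc)) (ℕₚ.≤-reflexive (ℕₚ.+-suc k (height x))))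

    climb-distance : ∀ {d} → IsDistance d → ∀ x y → height y ℕ.≤ d x y ℕ.+ height x
    climb-distance isDistance x y = climb-walk (proj₁ (isDistance x y))

    -- No walk is shorter than the climb between its ends, so a walk as long as its climb is a
    -- geodesic.
    steepest⇒distance : ∀ {d x y k} → IsDistance d → Walk x y k →
                        height y ≡ k ℕ.+ height x → d x y ≡ k
    steepest⇒distance {x = x} {y} isDistance w steep = ℕₚ.≤-antisym
      (proj₂ (isDistance x y) w)
      (ℕₚ.+-cancelʳ-≤ (height x) _ _
        (ℕₚ.≤-trans (ℕₚ.≤-reflexive (≡.sym steep)) (climb-distance isDistance x y)))

  infix 4 _∈ᵛ_
  _∈ᵛ_ : Vertex → List Vertex → Set (v ⊔ ℓ)
  x ∈ᵛ L = Any (x ≈_) L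

  _∈?_ : ∀ x L → Dec (x ∈ᵛ L)
  x ∈? L = Any.any? (x ≟_) L

  -- A vertex outside every layer gets the number of layers, which caps the height. Only the first
  -- layer containing a vertex counts, so layers may overlap.
  depth : List (List Vertex) → Vertex → ℕ
  depth []       x = 0
  depth (L ∷ Ls) x = if does (x ∈? L) then 0 else suc (depth Ls x)

  depth-head : ∀ {L Ls x} → x ∈ᵛ L → depth (L ∷ Ls) x ≡ 0
  depth-head {L} {x = x} x∈L with x ∈? L
  ... | yes _  = ≡.refl
  ... | no x∉L = ⊥-elim (x∉L x∈L)

  depth-tail : ∀ {L Ls x} → All (x ≉_) L → depth (L ∷ Ls) x ≡ suc (depth Ls x)
  depth-tail {L} {x = x} x∉L with x ∈? L
  ... | yes x∈L = ⊥-elim (All¬⇒¬Any x∉L x∈L)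
  ... | no _    = ≡.refl

  -- A certificate for the value of `depth`: for symbolic n the test `x ∈? L` does not reduce, so
  -- heights are read off from proofs of membership and non-membership.
  data Depth (x : Vertex) : List (List Vertex) → ℕ → Set (v ⊔ ℓ) where
    below : Depth x [] 0
    here  : ∀ {L Ls} → x ∈ᵛ L → Depth x (L ∷ Ls) 0
    there : ∀ {L Ls k} → All (x ≉_) L → Depth x Ls k → Depth x (L ∷ Ls) (suc k)

  Depth⇒depth : ∀ {Ls x k} → Depth x Ls k → depth Ls x ≡ k
  Depth⇒depth below = ≡.refl
  Depth⇒depth (here {Ls = Ls} x∈L) = depth-head {Ls = Ls} x∈L
  Depth⇒depth (there {Ls = Ls} x∉L deeper) =
    ≡.trans (depth-tail {Ls = Ls} x∉L) (≡.cong suc (Depth⇒depth {Ls} deeper))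

  depth-cong : ∀ Ls {x y} → x ≈ y → depth Ls x ≡ depth Ls y
  depth-cong []       x≈y = ≡.refl
  depth-cong (L ∷ Ls) {x} {y} x≈y with x ∈? L | y ∈? L
  ... | yes _   | yes _   = ≡.refl
  ... | yes x∈L | no y∉L  = ⊥-elim (y∉L (Any.map (trans (sym x≈y)) x∈L))
  ... | no x∉L  | yes y∈L = ⊥-elim (x∉L (Any.map (trans x≈y) y∈L))
  ... | no _    | no _    = ≡.cong suc (depth-cong Ls x≈y)

  OutNeighboursIn : List Vertex → Vertex → Set (v ⊔ ℓ ⊔ r)
  OutNeighboursIn M x = ∀ {y} → Arc x y → y ∈ᵛ M

  -- Arcs leaving a layer end in the next one, so the index of the first layer containing a
  -- vertex rises by at most one along an arc, whatever the graph distance is.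
  data Layered : List (List Vertex) → Set (v ⊔ ℓ ⊔ r) where
    [_]  : ∀ L → Layered (L ∷ [])
    _∷_  : ∀ {L M Ls} → All (OutNeighboursIn M) L → Layered (M ∷ Ls) → Layered (L ∷ M ∷ Ls)

  depth-climb : ∀ {Ls} → Layered Ls → ∀ {x y} → Arc x y → depth Ls y ℕ.≤ suc (depth Ls x)
  depth-climb {L ∷ Ls} layered {x} {y} arc with y ∈? L
  depth-climb layered arc | yes _ = ℕ.z≤n
  depth-climb [ L ] {x} arc | no _ = ℕ.s≤s ℕ.z≤n
  depth-climb {L ∷ M ∷ Ls} (nbrs ∷ layered) {x} {y} arc | no _ with x ∈? L
  ... | no _    = ℕ.s≤s (depth-climb layered arc)
  ... | yes x∈L = ℕ.s≤s (ℕₚ.≤-reflexive (depth-head {M} {Ls} y∈M))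
    where
    y∈M : y ∈ᵛ M
    y∈M = All.lookupWith (λ nbrsIn x≈z → nbrsIn (proj₂ resp x≈z arc)) nbrs x∈L

  layerPotential : ∀ {Ls} → Layered Ls → Potential
  layerPotential {Ls} layered = record
    { height = depth Ls
    ; cong   = depth-cong Ls
    ; climb  = depth-climb layered
    }

  layers-climb : ∀ {Ls} (layered : Layered Ls) → let open Potential (layerPotential layered) in
                 ∀ {x y i} k → Depth x Ls i → Depth y Ls (k ℕ.+ i) → height y ≡ k ℕ.+ height x
  layers-climb {Ls} layered k dx dy =
    ≡.trans (Depth⇒depth {Ls} dy) (≡.cong (k ℕ.+_) (≡.sym (Depth⇒depth {Ls} dx)))

  record OutNeighbours (x y z : Vertex) : Set (v ⊔ ℓ ⊔ r) where
    field
      arcˡ      : Arc x y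
      arcʳ      : Arc x z
      distinct  : y ≉ z
      exhausted : ∀ {u} → Arc x u → u ≈ y ⊎ u ≈ z

  -- Duplicate-free lists with the same elements are permutations of each other, so the filtered
  -- enumeration is as long as the list of the two indices.
  d-out≡2 : ∀ {x y z} → OutNeighbours x y z → d-out x ≡ 2
  d-out≡2 {x} {y} {z} out = ↭-length (∼bag⇒↭ (unique∧set⇒bag
    (Unique.filter⁺ arc? (Unique.allFin⁺ order))
    ((index-distinct ∷ []) ∷ ([] ∷ []))
    (mk⇔ to from)))
    where
    open OutNeighbours out
    arc? = λ i → Arc? x (vertex i)

    index-distinct : index y ≢ index z
    index-distinct eq = distinct
      (trans (sym (vertex-index y)) (trans (reflexive (≡.cong vertex eq)) (vertex-index z)))

    index-unique : ∀ {i u} → vertex i ≈ u → i ≡ index u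
    index-unique eq = ≡.sym (Inverse.inverseʳ enum (sym eq))

    to : ∀ {i} → i ∈ N-out x → i ∈ index y ∷ index z ∷ []
    to i∈ with exhausted (proj₂ (∈-filter⁻ arc? {xs = allFin order} i∈))
    ... | inj₁ eq = here (index-unique eq)
    ... | inj₂ eq = there (here (index-unique eq))

    from : ∀ {i} → i ∈ index y ∷ index z ∷ [] → i ∈ N-out x
    from (here ≡.refl) =
      ∈-filter⁺ arc? (∈-allFin (index y)) (proj₁ resp (sym (vertex-index y)) arcˡ)
    from (there (here ≡.refl)) =
      ∈-filter⁺ arc? (∈-allFin (index z)) (proj₁ resp (sym (vertex-index z)) arcʳ)

-- Transport plans, Kantorovich duality and curvature

module Transport {c ℓ₁ ℓ₂ v ℓ r} (ℝ : RealNumbers c ℓ₁ ℓ₂) (Γ : FiniteDigraph v ℓ r) where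
  open RealNumbers ℝ
  open RealProperties ℝ
  open FiniteDigraph Γ using (Vertex; order; vertex; index; Arc; Arc?; _≟_; d-out; d-out-nonZero;
    IsDistance; distance-nonZero; noLoops; Walk; stop; step)
    renaming (_≈_ to _≈ᵛ_; _≉_ to _≉ᵛ_; refl to reflᵛ; sym to symᵛ; trans to transᵛ)
  open DigraphProperties Γ
  open Curvature ℝ Γ
  open SetoidReasoning setoid hiding (stop)

  indicator : ∀ {p} {P : Set p} → Dec P → Carrier
  indicator (yes _) = 1#
  indicator (no _)  = 0#

  indicator-yes : ∀ {p} {P : Set p} (P? : Dec P) → P → indicator P? ≈ 1#
  indicator-yes (yes _) _ = refl
  indicator-yes (no ¬p) p = ⊥-elim (¬p p)

  indicator-no : ∀ {p} {P : Set p} (P? : Dec P) → ¬ P → indicator P? ≈ 0#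
  indicator-no (yes p) ¬p = ⊥-elim (¬p p)
  indicator-no (no _)  _  = refl

  indicator-cong : ∀ {p q} {P : Set p} {Q : Set q} (P? : Dec P) (Q? : Dec Q) →
                   (P → Q) → (Q → P) → indicator P? ≈ indicator Q?
  indicator-cong (yes p) Q? P⇒Q _ = sym (indicator-yes Q? (P⇒Q p))
  indicator-cong (no ¬p) Q? _ Q⇒P = sym (indicator-no Q? (¬p ∘ Q⇒P))

  δ : Vertex → Vertex → Carrier
  δ x y = indicator (y ≟ x)

  δ-yes : ∀ {x y} → y ≈ᵛ x → δ x y ≈ 1#
  δ-yes = indicator-yes (_ ≟ _)

  δ-no : ∀ {x y} → y ≉ᵛ x → δ x y ≈ 0#
  δ-no = indicator-no (_ ≟ _)

  δ-cong : ∀ {x x′ y y′} → x ≈ᵛ x′ → y ≈ᵛ y′ → δ x y ≈ δ x′ y′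
  δ-cong x≈x′ y≈y′ = indicator-cong (_ ≟ _) (_ ≟ _)
    (λ y≈x → transᵛ (symᵛ y≈y′) (transᵛ y≈x x≈x′))
    (λ y′≈x′ → transᵛ y≈y′ (transᵛ y′≈x′ (symᵛ x≈x′)))

  ∑-cong : ∀ {f g} → (∀ x → f x ≈ g x) → ∑ f ≈ ∑ g
  ∑-cong f≈g = sum-cong-≋ (f≈g ∘ vertex)

  ∑-distribˡ : ∀ a f → a * ∑ f ≈ ∑ (λ x → a * f x)
  ∑-distribˡ a f = *-distribˡ-sum a (f ∘ vertex)

  ∑-distribʳ : ∀ a f → ∑ f * a ≈ ∑ (λ x → f x * a)
  ∑-distribʳ a f = trans (*-comm _ a) (trans (∑-distribˡ a f) (∑-cong λ x → *-comm a (f x)))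

  ∑-+ : ∀ f g → ∑ (λ x → f x + g x) ≈ ∑ f + ∑ g
  ∑-+ f g = ∑-distrib-+ (f ∘ vertex) (g ∘ vertex)

  ∑-mono-≤ : ∀ {f g} → (∀ x → f x ≤ g x) → ∑ f ≤ ∑ g
  ∑-mono-≤ f≤g = sum-mono-≤ (f≤g ∘ vertex)

  ∑∑-comm : ∀ (f : Vertex → Vertex → Carrier) →
            ∑ (λ x → ∑ (λ y → f x y)) ≈ ∑ (λ y → ∑ (λ x → f x y))
  ∑∑-comm f = ∑-comm (λ i j → f (vertex i) (vertex j))

  ∑-δ* : ∀ x (f : Vertex → Carrier) → (∀ {y z} → y ≈ᵛ z → f y ≈ f z) → ∑ (λ y → δ x y * f y) ≈ f x
  ∑-δ* x f f-cong = begin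
    ∑ (λ y → δ x y * f y)                                ≈⟨ sum-single _ (index x) elsewhere ⟩
    δ x (vertex (index x)) * f (vertex (index x))        ≈⟨ *-cong (δ-yes (vertex-index x))
                                                                   (f-cong (vertex-index x)) ⟩
    1# * f x                                             ≈⟨ *-identityˡ (f x) ⟩
    f x                                                  ∎
    where
    elsewhere : ∀ j → j ≢ index x → δ x (vertex j) * f (vertex j) ≈ 0#
    elsewhere j j≢x = trans
      (*-congʳ (δ-no λ eq → j≢x (≡.sym (Inverse.inverseʳ (FiniteDigraph.enum Γ) (symᵛ eq)))))
      (zeroˡ _)

  ∑-δ : ∀ x → ∑ (δ x) ≈ 1#
  ∑-δ x = trans (∑-cong λ y → sym (*-identityʳ (δ x y))) (∑-δ* x (λ _ → 1#) λ _ → refl)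

  -- A finitely supported coupling: each entry (m , x , y) moves the mass m from x to y.
  Plan : Set (c ⊔ v)
  Plan = List (Carrier × Vertex × Vertex)

  -- The integral of g against the discrete measure of the plan on pairs of vertices; total mass,
  -- marginals and cost are all of this form.
  ⟪_⟫ : Plan → (Vertex → Vertex → Carrier) → Carrier
  ⟪ []               ⟫ g = 0#
  ⟪ (m , x , y) ∷ P ⟫ g = m * g x y + ⟪ P ⟫ g

  ⟪⟫-cong : ∀ P {f g} → All (λ (_ , x , y) → f x y ≈ g x y) P → ⟪ P ⟫ f ≈ ⟪ P ⟫ g
  ⟪⟫-cong []      []            = refl
  ⟪⟫-cong (_ ∷ P) (f≈g ∷ P-f≈g) = +-cong (*-congˡ f≈g) (⟪⟫-cong P P-f≈g)

  ⟪⟫-cong-≗ : ∀ P {f g} → (∀ x y → f x y ≈ g x y) → ⟪ P ⟫ f ≈ ⟪ P ⟫ g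
  ⟪⟫-cong-≗ P f≈g = ⟪⟫-cong P (All.universal (λ (_ , x , y) → f≈g x y) P)

  ⟪⟫-+ : ∀ P f g → ⟪ P ⟫ (λ x y → f x y + g x y) ≈ ⟪ P ⟫ f + ⟪ P ⟫ g
  ⟪⟫-+ []                f g = sym (+-identityˡ 0#)
  ⟪⟫-+ ((m , x , y) ∷ P) f g = trans (+-congˡ (⟪⟫-+ P f g))
    (solve 5 (λ m a b s t → m :* (a :+ b) :+ (s :+ t) := (m :* a :+ s) :+ (m :* b :+ t))
      refl m (f x y) (g x y) (⟪ P ⟫ f) (⟪ P ⟫ g))
    where open SemiringSolver commutativeSemiring

  ⟪⟫-*ʳ : ∀ P f a → ⟪ P ⟫ f * a ≈ ⟪ P ⟫ (λ x y → f x y * a)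
  ⟪⟫-*ʳ []                f a = zeroˡ a
  ⟪⟫-*ʳ ((m , x , y) ∷ P) f a = trans (distribʳ a _ _) (+-cong (*-assoc m _ a) (⟪⟫-*ʳ P f a))

  ⟪⟫-∑ : ∀ P (f : Vertex → Vertex → Vertex → Carrier) →
         ∑ (λ z → ⟪ P ⟫ (f z)) ≈ ⟪ P ⟫ (λ x y → ∑ (λ z → f z x y))
  ⟪⟫-∑ []                f = sum-replicate-zero order
  ⟪⟫-∑ ((m , x , y) ∷ P) f = begin
    ∑ (λ z → m * f z x y + ⟪ P ⟫ (f z))
      ≈⟨ ∑-+ (λ z → m * f z x y) (λ z → ⟪ P ⟫ (f z)) ⟩
    ∑ (λ z → m * f z x y) + ∑ (λ z → ⟪ P ⟫ (f z))
      ≈⟨ +-cong (sym (∑-distribˡ m λ z → f z x y)) (⟪⟫-∑ P f) ⟩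
    m * ∑ (λ z → f z x y) + ⟪ P ⟫ (λ x y → ∑ (λ z → f z x y))
      ∎

  NonNegative : Plan → Set (c ⊔ v ⊔ ℓ₂)
  NonNegative = All (λ (m , _ , _) → 0# ≤ m)

  indicator-bounds : ∀ {m p q} {P : Set p} {Q : Set q} → 0# ≤ m →
    (P? : Dec P) (Q? : Dec Q) →
    (0# ≤ m * (indicator P? * indicator Q?)) × (m * (indicator P? * indicator Q?) ≤ m * 1#)
  indicator-bounds {m} 0≤m P? Q? = bounds P? Q?
    where
    Bounds : Carrier → Set ℓ₂
    Bounds x = (0# ≤ m * x) × (m * x ≤ m * 1#)
    one-weight : ∀ {x} → x ≈ 1# → Bounds x
    one-weight x≈1 = ≤-resp refl (sym (trans (*-congˡ x≈1) (*-identityʳ m))) 0≤m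
                   , ≤-reflexive (*-congˡ x≈1)
    zero-weight : ∀ {x} → x ≈ 0# → Bounds x
    zero-weight x≈0 = ≤-reflexive (sym m*x≈0) , ≤-resp (sym m*x≈0) (sym (*-identityʳ m)) 0≤m
      where m*x≈0 = trans (*-congˡ x≈0) (zeroʳ m)
    bounds : ∀ {p q} {P : Set p} {Q : Set q} (P? : Dec P) (Q? : Dec Q) →
             Bounds (indicator P? * indicator Q?)
    bounds (no _)  Q?      = zero-weight (zeroˡ _)
    bounds (yes _) (no _)  = zero-weight (zeroʳ 1#)
    bounds (yes _) (yes _) = one-weight (*-identityˡ 1#)

  matrix : Plan → Vertex → Vertex → Carrier
  matrix P x y = ⟪ P ⟫ λ s t → δ s x * δ t y

  -- Each entry collects a part of the total mass; once that mass is 1, this is the bound `A≤1`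
  -- demanded of a coupling.
  matrix-bounds : ∀ {P} → NonNegative P → ∀ x y →
                  (0# ≤ matrix P x y) × (matrix P x y ≤ ⟪ P ⟫ λ _ _ → 1#)
  matrix-bounds {[]} [] x y = ≤-reflexive refl , ≤-reflexive refl
  matrix-bounds {(_ , s , t) ∷ _} (0≤m ∷ 0≤P) x y =
      0≤x+y (proj₁ (indicator-bounds 0≤m (x ≟ s) (y ≟ t))) (proj₁ (matrix-bounds 0≤P x y))
    , +-mono-≤ (proj₂ (indicator-bounds 0≤m (x ≟ s) (y ≟ t))) (proj₂ (matrix-bounds 0≤P x y))

  ∑-matrixˡ : ∀ P x → ∑ (λ y → matrix P x y) ≈ ⟪ P ⟫ λ s t → δ s x
  ∑-matrixˡ P x = trans (⟪⟫-∑ P λ y s t → δ s x * δ t y)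
    (⟪⟫-cong-≗ P λ s t → trans (sym (∑-distribˡ (δ s x) (δ t)))
      (trans (*-congˡ (∑-δ t)) (*-identityʳ (δ s x))))

  ∑-matrixʳ : ∀ P y → ∑ (λ x → matrix P x y) ≈ ⟪ P ⟫ λ s t → δ t y
  ∑-matrixʳ P y = trans (⟪⟫-∑ P λ x s t → δ s x * δ t y)
    (⟪⟫-cong-≗ P λ s t → trans (sym (∑-distribʳ (δ t y) (δ s)))
      (trans (*-congʳ (∑-δ s)) (*-identityˡ (δ t y))))

  -- With the sums moved inside the plan, the point masses sift out one value of g, in the second
  -- argument and then in the first. Sifting lands on an enumerated representative, whence the
  -- congruence hypothesis.
  ∑∑-matrix : ∀ P (g : Vertex → Vertex → Carrier) →
    (∀ {x x′ y y′} → x ≈ᵛ x′ → y ≈ᵛ y′ → g x y ≈ g x′ y′) →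
    ∑ (λ x → ∑ λ y → matrix P x y * g x y) ≈ ⟪ P ⟫ g
  ∑∑-matrix P g g-cong = begin
    ∑ (λ x → ∑ λ y → matrix P x y * g x y)
      ≈⟨ ∑-cong (λ x → ∑-cong λ y → ⟪⟫-*ʳ P (λ s t → δ s x * δ t y) (g x y)) ⟩
    ∑ (λ x → ∑ λ y → ⟪ P ⟫ λ s t → δ s x * δ t y * g x y)
      ≈⟨ ∑-cong (λ x → ⟪⟫-∑ P λ y s t → δ s x * δ t y * g x y) ⟩
    ∑ (λ x → ⟪ P ⟫ λ s t → ∑ λ y → δ s x * δ t y * g x y)
      ≈⟨ ⟪⟫-∑ P (λ x s t → ∑ λ y → δ s x * δ t y * g x y) ⟩
    ⟪ P ⟫ (λ s t → ∑ λ x → ∑ λ y → δ s x * δ t y * g x y)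
      ≈⟨ ⟪⟫-cong-≗ P (λ s t → trans (∑-cong (inner s t))
                                    (∑-δ* s (λ x → g x t) λ eq → g-cong eq reflᵛ)) ⟩
    ⟪ P ⟫ g
      ∎
    where
    inner : ∀ s t x → ∑ (λ y → δ s x * δ t y * g x y) ≈ δ s x * g x t
    inner s t x = begin
      ∑ (λ y → δ s x * δ t y * g x y)    ≈⟨ ∑-cong (λ y → *-assoc (δ s x) (δ t y) (g x y)) ⟩
      ∑ (λ y → δ s x * (δ t y * g x y))  ≈⟨ ∑-distribˡ (δ s x) (λ y → δ t y * g x y) ⟨
      δ s x * ∑ (λ y → δ t y * g x y)    ≈⟨ *-congˡ (∑-δ* t (g x) (g-cong reflᵛ)) ⟩
      δ s x * g x t                      ∎

  record PlanBetween (μ ν : Vertex → Carrier) (P : Plan) : Set (c ⊔ ℓ₁ ⊔ ℓ₂ ⊔ v) where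
    field
      nonNegative : NonNegative P
      totalMass   : ⟪ P ⟫ (λ _ _ → 1#) ≈ 1#
      sources     : ∀ x → ⟪ P ⟫ (λ s t → δ s x) ≈ μ x
      targets     : ∀ y → ⟪ P ⟫ (λ s t → δ t y) ≈ ν y

    matrix-isCoupling : IsCoupling μ ν (matrix P)
    matrix-isCoupling = record
      { A-cong    = λ x≈x′ y≈y′ → ⟪⟫-cong-≗ P λ s t → *-cong (δ-cong reflᵛ x≈x′) (δ-cong reflᵛ y≈y′)
      ; 0≤A       = λ x y → proj₁ (matrix-bounds nonNegative x y)
      ; A≤1       = λ x y → ≤-resp refl totalMass (proj₂ (matrix-bounds nonNegative x y))
      ; marginalˡ = λ x → trans (∑-matrixˡ P x) (sources x)
      ; marginalʳ = λ y → trans (∑-matrixʳ P y) (targets y)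
      }

  module _ {d} (isDistance : IsDistance d) (φ : Potential) where
    open Potential φ

    private
      h : Vertex → Carrier
      h x = fromℕ (height x)

      h-cong : ∀ {x y} → x ≈ᵛ y → h x ≈ h y
      h-cong x≈y = reflexive (≡.cong fromℕ (Potential.cong φ x≈y))

    d-cong : ∀ {x x′ y y′} → x ≈ᵛ x′ → y ≈ᵛ y′ → d x y ≡ d x′ y′
    d-cong {x} {x′} {y} {y′} x≈x′ y≈y′ = ℕₚ.≤-antisym
      (proj₂ (isDistance x y) (Walk-resp (symᵛ x≈x′) (symᵛ y≈y′) (proj₁ (isDistance x′ y′))))
      (proj₂ (isDistance x′ y′) (Walk-resp x≈x′ y≈y′ (proj₁ (isDistance x y))))

    -- The weak half of Kantorovich duality, with the potential of the source moved to the left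
    -- so that heights stay natural numbers.
    weakDuality : ∀ {μ ν A} → IsCoupling μ ν A →
                  ∑ (λ y → ν y * h y) ≤ cost d A + ∑ (λ x → μ x * h x)
    weakDuality {μ} {ν} {A} coupling = ≤-resp left right
      (∑-mono-≤ λ x → ∑-mono-≤ λ y →
        *fromℕ-mono-≤ (0≤A x y) (climb-distance isDistance x y))
      where
      open IsCoupling coupling
      left : ∑ (λ x → ∑ λ y → A x y * h y) ≈ ∑ (λ y → ν y * h y)
      left = trans (∑∑-comm λ x y → A x y * h y)
        (∑-cong λ y → trans (sym (∑-distribʳ (h y) λ x → A x y)) (*-congʳ (marginalʳ y)))
      right : ∑ (λ x → ∑ λ y → A x y * fromℕ (d x y ℕ.+ height x)) ≈
              cost d A + ∑ (λ x → μ x * h x)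
      right = begin
        ∑ (λ x → ∑ λ y → A x y * fromℕ (d x y ℕ.+ height x))
          ≈⟨ ∑-cong (λ x → ∑-cong λ y → trans (*-congˡ (fromℕ-homo-+ (d x y) (height x)))
                                              (distribˡ (A x y) _ _)) ⟩
        ∑ (λ x → ∑ λ y → A x y * fromℕ (d x y) + A x y * h x)
          ≈⟨ ∑-cong (λ x → ∑-+ (λ y → A x y * fromℕ (d x y)) (λ y → A x y * h x)) ⟩
        ∑ (λ x → (∑ λ y → A x y * fromℕ (d x y)) + (∑ λ y → A x y * h x))
          ≈⟨ ∑-+ (λ x → ∑ λ y → A x y * fromℕ (d x y)) (λ x → ∑ λ y → A x y * h x) ⟩
        cost d A + ∑ (λ x → ∑ λ y → A x y * h x)
          ≈⟨ +-congˡ (∑-cong λ x → trans (sym (∑-distribʳ (h x) (A x))) (*-congʳ (marginalˡ x))) ⟩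
        cost d A + ∑ (λ x → μ x * h x)
          ∎

    -- Complementary slackness: a plan along which the potential climbs at full speed is optimal.
    steepest⇒optimal : ∀ {μ ν P} → PlanBetween μ ν P →
      All (λ (_ , x , y) → height y ≡ d x y ℕ.+ height x) P →
      IsWasserstein d μ ν (⟪ P ⟫ λ x y → fromℕ (d x y))
    steepest⇒optimal {μ} {ν} {P} plan steep = lowerBound , attained
      where
      open PlanBetween plan
      w = ⟪ P ⟫ λ x y → fromℕ (d x y)

      cost≈w : cost d (matrix P) ≈ w
      cost≈w = ∑∑-matrix P (λ x y → fromℕ (d x y)) λ p q → reflexive (≡.cong fromℕ (d-cong p q))

      integralˡ : ∑ (λ x → μ x * h x) ≈ ⟪ P ⟫ λ s t → h s
      integralˡ = begin
        ∑ (λ x → μ x * h x)                        ≈⟨ ∑-cong (λ x → *-congʳ {h x} (sources x)) ⟨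
        ∑ (λ x → ⟪ P ⟫ (λ s t → δ s x) * h x)      ≈⟨ ∑-cong (λ x → ⟪⟫-*ʳ P (λ s t → δ s x) (h x)) ⟩
        ∑ (λ x → ⟪ P ⟫ (λ s t → δ s x * h x))      ≈⟨ ⟪⟫-∑ P (λ x s t → δ s x * h x) ⟩
        ⟪ P ⟫ (λ s t → ∑ (λ x → δ s x * h x))      ≈⟨ ⟪⟫-cong-≗ P (λ s t → ∑-δ* s h h-cong) ⟩
        ⟪ P ⟫ (λ s t → h s)                        ∎

      integralʳ : ∑ (λ y → ν y * h y) ≈ ⟪ P ⟫ λ s t → h t
      integralʳ = begin
        ∑ (λ y → ν y * h y)                        ≈⟨ ∑-cong (λ y → *-congʳ {h y} (targets y)) ⟨
        ∑ (λ y → ⟪ P ⟫ (λ s t → δ t y) * h y)      ≈⟨ ∑-cong (λ y → ⟪⟫-*ʳ P (λ s t → δ t y) (h y)) ⟩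
        ∑ (λ y → ⟪ P ⟫ (λ s t → δ t y * h y))      ≈⟨ ⟪⟫-∑ P (λ y s t → δ t y * h y) ⟩
        ⟪ P ⟫ (λ s t → ∑ (λ y → δ t y * h y))      ≈⟨ ⟪⟫-cong-≗ P (λ s t → ∑-δ* t h h-cong) ⟩
        ⟪ P ⟫ (λ s t → h t)                        ∎

      w+integralˡ : w + ⟪ P ⟫ (λ s t → h s) ≈ ⟪ P ⟫ (λ s t → h t)
      w+integralˡ = trans (sym (⟪⟫-+ P _ _)) (⟪⟫-cong P (All.map
        (λ {(_ , x , y)} eq → trans (sym (fromℕ-homo-+ (d x y) (height x)))
                                    (reflexive (≡.cong fromℕ (≡.sym eq)))) steep))

      lowerBound : ∀ t → ∃[ A ] IsCoupling μ ν A × (t ≈ cost d A) → w ≤ t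
      lowerBound t (A , coupling , t≈cost) = +-cancelʳ-≤ (⟪ P ⟫ λ s t → h s)
        (≤-resp (trans integralʳ (sym w+integralˡ)) (+-cong (sym t≈cost) integralˡ)
          (weakDuality coupling))

      attained : ∀ η → 0# < η → ∃[ t ] (∃[ A ] IsCoupling μ ν A × (t ≈ cost d A)) × t < w + η
      attained η 0<η = w , (matrix P , matrix-isCoupling , sym cost≈w) , x<x+ε 0<η

  -- As a combination of point masses the walk turns the marginal conditions of a plan into semiring
  -- identities. Absence of loops and distinctness of y and z keep the three masses apart.
  lazyWalk-δ : ∀ α {x y z} → OutNeighbours x y z → ∀ u →
               lazyWalk α x u ≈ α * δ x u + ((1# - α) * ½ * δ y u + (1# - α) * ½ * δ z u)
  lazyWalk-δ α {x} {y} {z} out u with u ≟ x | Arc? x u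
  ... | yes u≈x | _ = sym (begin
    α * 1# + (q * δ y u + q * δ z u)
      ≈⟨ +-cong (*-identityʳ α) (+-cong (*-congˡ (δ-no λ u≈y → noLoops arcˡ (transᵛ (symᵛ u≈x) u≈y)))
                                        (*-congˡ (δ-no λ u≈z → noLoops arcʳ (transᵛ (symᵛ u≈x) u≈z)))) ⟩
    α + (q * 0# + q * 0#)
      ≈⟨ solve 2 (λ a q → a :+ (q :* con 0 :+ q :* con 0) := a) refl α q ⟩
    α
      ∎)
    where
    open OutNeighbours out
    open SemiringSolver commutativeSemiring
    q = (1# - α) * ½
  ... | no u≉x | no ¬arc = sym (begin
    α * 0# + (q * δ y u + q * δ z u)
      ≈⟨ +-congˡ (+-cong (*-congˡ (δ-no λ u≈y → ¬arc (proj₁ resp (symᵛ u≈y) arcˡ)))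
                         (*-congˡ (δ-no λ u≈z → ¬arc (proj₁ resp (symᵛ u≈z) arcʳ)))) ⟩
    α * 0# + (q * 0# + q * 0#)
      ≈⟨ solve 2 (λ a q → a :* con 0 :+ (q :* con 0 :+ q :* con 0) := con 0) refl α q ⟩
    0#
      ∎)
    where
    open OutNeighbours out
    open FiniteDigraph Γ using (resp)
    open SemiringSolver commutativeSemiring
    q = (1# - α) * ½
  ... | no u≉x | yes arc = trans
      (/ℕ-congʳ (1# - α) {{d-out-nonZero arc}} (d-out≡2 out))
      (trans (x/ℕ2≈x*½ (1# - α)) (sym (δ-sum (exhausted arc))))
    where
    open OutNeighbours out
    open SemiringSolver commutativeSemiring
    q = (1# - α) * ½
    δ-sum : u ≈ᵛ y ⊎ u ≈ᵛ z → α * 0# + (q * δ y u + q * δ z u) ≈ q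
    δ-sum (inj₁ u≈y) = trans
      (+-congˡ (+-cong (*-congˡ (δ-yes u≈y))
                       (*-congˡ (δ-no λ u≈z → distinct (transᵛ (symᵛ u≈y) u≈z)))))
      (solve 2 (λ a q → a :* con 0 :+ (q :* con 1 :+ q :* con 0) := q) refl α q)
    δ-sum (inj₂ u≈z) = trans
      (+-congˡ (+-cong (*-congˡ (δ-no λ u≈y → distinct (transᵛ (symᵛ u≈y) u≈z)))
                       (*-congˡ (δ-yes u≈z))))
      (solve 2 (λ a q → a :* con 0 :+ (q :* con 0 :+ q :* con 1) := q) refl α q)

  module _ {d} (isDistance : IsDistance d) where

    -- The ends of an arc are at distance 1, so W = 1 - (1 - α)κ makes the quotient under the limit
    -- equal to κ, and every tolerance is met at once. Writing the equation as a sum suits the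
    -- semiring solver.
    ricciCurvature : ∀ {x y κ} (x≉y : x ≉ᵛ y) → Arc x y →
      (∀ α → 0# ≤ α → α < 1# → 1# - α < ½ →
        ∃[ w ] IsWasserstein d (lazyWalk α x) (lazyWalk α y) w × (w + (1# - α) * κ ≈ 1#)) →
      IsRicciCurvature x y x≉y κ
    ricciCurvature {x} {y} {κ} x≉y arc wasserstein =
      d , isDistance , λ η 0<η → ½ , 0<½ , λ α 0≤α α<1 1-α<½ →
        let w , isW , w+[1-α]κ≈1 = wasserstein α 0≤α α<1 1-α<½
            κα  = 1# - (w /ℕ d x y) {{distance-nonZero isDistance x≉y}}
            κα≈ = trans (+-congˡ (-‿cong (w/d≈w w)))
                    (sym (x+y≈z⇒x≈z-y (trans (+-comm _ w) w+[1-α]κ≈1)))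
            q≈κ = quotient-cancel κα (#-sym (<⇒# α<1)) κα≈
        in κα , (w , isW , refl) , x≈y⇒x-y<ε q≈κ 0<η , x≈y⇒x-y<ε (sym q≈κ) 0<η
      where
      dxy≡1 : d x y ≡ 1
      dxy≡1 = ℕₚ.≤-antisym (proj₂ (isDistance x y) (step arc (stop reflᵛ)))
        (ℕ.>-nonZero⁻¹ (d x y) {{distance-nonZero isDistance x≉y}})
      w/d≈w : ∀ w → (w /ℕ d x y) {{distance-nonZero isDistance x≉y}} ≈ w
      w/d≈w w = trans (/ℕ-congʳ w {{distance-nonZero isDistance x≉y}} dxy≡1) (/ℕ1 w)

    -- Both plans split the mass α at x into `rest`, moved to y, and one share `q`. The threshold ½
    -- gives q < 1 - α < ½ < α, which keeps `rest` nonnegative.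
    module Masses {α} (α<1 : α < 1#) (1-α<½ : 1# - α < ½) where
      q rest : Carrier
      q    = (1# - α) * ½
      rest = α - q

      rest+q≈α : rest + q ≈ α
      rest+q≈α = x-y+y≈x α q

      rest+3q≈1 : rest + q + (q + q) ≈ 1#
      rest+3q≈1 = trans (+-cong rest+q≈α (x*½+x*½≈x (1# - α)))
        (trans (+-comm α (1# - α)) (x-y+y≈x 1# α))

      0<q : 0# < q
      0<q = *-positive (x<y⇒0<y-x α<1) 0<½

      q<1-α : q < 1# - α
      q<1-α = <-resp (+-identityʳ q) (x*½+x*½≈x (1# - α)) (+-monoʳ-< q 0<q)

      ½<α : ½ < α
      ½<α = +-cancelˡ-< (1# - α) (<-resp (+-comm ½ (1# - α)) (trans ½+½≈1 (sym (x-y+y≈x 1# α)))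
        (+-monoʳ-< ½ 1-α<½))

      0≤q : 0# ≤ q
      0≤q = <⇒≤ 0<q

      0≤rest : 0# ≤ rest
      0≤rest = <⇒≤ (x<y⇒0<y-x (<-trans q<1-α (<-trans 1-α<½ ½<α)))

    module _ (φ : Potential) where
      open Potential φ using (height; steepest⇒distance)

      private
        dist : ∀ {x y k} → Walk x y k → height y ≡ k ℕ.+ height x → d x y ≡ k
        dist = steepest⇒distance isDistance

        dist-refl : ∀ x → d x x ≡ 0
        dist-refl x = dist (stop reflᵛ) ≡.refl

        steep : ∀ {x y k} → Walk x y k → height y ≡ k ℕ.+ height x →
                height y ≡ d x y ℕ.+ height x
        steep {x} w climbs = ≡.trans climbs (≡.cong (ℕ._+ height x) (≡.sym (dist w climbs)))

        steep-refl : ∀ x → height x ≡ d x x ℕ.+ height x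
        steep-refl x = steep (stop reflᵛ) ≡.refl

        m*d : ∀ m {x y k} → d x y ≡ k → m * fromℕ (d x y) ≈ m * fromℕ k
        m*d m eq = *-congˡ (reflexive (≡.cong fromℕ eq))

      open SemiringSolver commutativeSemiring

      -- In an optimal plan y keeps the mass common to both walks, x supplies y and t, and z supplies u.
      curvature-forward : ∀ {x y z u t k κ} (x≉y : x ≉ᵛ y) →
        OutNeighbours x y z → OutNeighbours y u t → Walk z u k →
        height y ≡ 1 ℕ.+ height x → height t ≡ 2 ℕ.+ height x → height u ≡ k ℕ.+ height z →
        κ + ½ * fromℕ k ≈ ½ → IsRicciCurvature x y x≉y κ
      curvature-forward {x} {y} {z} {u} {t} {k} {κ} x≉y outˣ outʸ z→u climb-y climb-t climb-u κ+½k≈½ =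
        ricciCurvature x≉y x→y λ α 0≤α α<1 1-α<½ → wasserstein α<1 1-α<½
        where
        open OutNeighbours outˣ using () renaming (arcˡ to x→y)
        open OutNeighbours outʸ using () renaming (arcʳ to y→t)
        walk-y : Walk x y 1
        walk-y = step x→y (stop reflᵛ)
        walk-t : Walk x t 2
        walk-t = step x→y (step y→t (stop reflᵛ))

        wasserstein : ∀ {α} → α < 1# → 1# - α < ½ →
          ∃[ w ] IsWasserstein d (lazyWalk α x) (lazyWalk α y) w × (w + (1# - α) * κ ≈ 1#)
        wasserstein {α} α<1 1-α<½ =
            _
          , steepest⇒optimal isDistance φ plan
              (steep-refl y ∷ steep walk-y climb-y ∷ steep walk-t climb-t ∷ steep z→u climb-u ∷ [])
          , (begin
          q * fromℕ (d y y) + (rest * fromℕ (d x y) + (q * fromℕ (d x t) + (q * fromℕ (d z u) + 0#)))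
            + β * κ
            ≈⟨ +-congʳ (+-cong (m*d q (dist-refl y)) (+-cong (m*d rest (dist walk-y climb-y))
                 (+-cong (m*d q (dist walk-t climb-t)) (+-congʳ (m*d q (dist z→u climb-u)))))) ⟩
          q * fromℕ 0 + (rest * fromℕ 1 + (q * fromℕ 2 + (q * fromℕ k + 0#))) + β * κ
            -- `q` is entered as β times ½ to expose the factor `κ + ½ * fromℕ k`, through which
            -- alone κ and k enter.
            ≈⟨ solve 5 (λ β ½ r k κ →
                 β :* ½ :* con 0 :+ (r :* (con 1 :+ con 0) :+ (β :* ½ :* (con 1 :+ (con 1 :+ con 0))
                   :+ (β :* ½ :* k :+ con 0))) :+ β :* κ
                 := r :+ β :* (κ :+ ½ :* k) :+ (β :* ½ :+ β :* ½))
                 refl β ½ rest (fromℕ k) κ ⟩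
          rest + β * (κ + ½ * fromℕ k) + (q + q)
            ≈⟨ +-congʳ (+-congˡ (*-congˡ κ+½k≈½)) ⟩
          rest + q + (q + q)
            ≈⟨ rest+3q≈1 ⟩
          1#
            ∎)
          where
          open Masses α<1 1-α<½
          β = 1# - α
          P : Plan
          P = (q , y , y) ∷ (rest , x , y) ∷ (q , x , t) ∷ (q , z , u) ∷ []
          plan : PlanBetween (lazyWalk α x) (lazyWalk α y) P
          plan = record
            { nonNegative = 0≤q ∷ 0≤rest ∷ 0≤q ∷ 0≤q ∷ []
            ; totalMass   = trans
                (solve 2 (λ q r → q :* con 1 :+ (r :* con 1 :+ (q :* con 1 :+ (q :* con 1 :+ con 0)))
                                  := r :+ q :+ (q :+ q)) refl q rest)
                rest+3q≈1
            ; sources     = λ v → trans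
                (solve 5 (λ q r x y z → q :* y :+ (r :* x :+ (q :* x :+ (q :* z :+ con 0)))
                                        := (r :+ q) :* x :+ (q :* y :+ q :* z))
                  refl q rest (δ x v) (δ y v) (δ z v))
                (trans (+-congʳ (*-congʳ rest+q≈α)) (sym (lazyWalk-δ α outˣ v)))
            ; targets     = λ v → trans
                (solve 5 (λ q r y u t → q :* y :+ (r :* y :+ (q :* t :+ (q :* u :+ con 0)))
                                        := (r :+ q) :* y :+ (q :* u :+ q :* t))
                  refl q rest (δ y v) (δ u v) (δ t v))
                (trans (+-congʳ (*-congʳ rest+q≈α)) (sym (lazyWalk-δ α outʸ v)))
            }

      -- Along a 2-cycle x → y → x both endpoints keep the mass common to the two walks.
      curvature-2cycle : ∀ {x y z u k κ} (x≉y : x ≉ᵛ y) →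
        OutNeighbours x z y → OutNeighbours y u x → Walk z u k →
        height y ≡ 1 ℕ.+ height x → height u ≡ k ℕ.+ height z →
        κ + ½ * fromℕ k ≈ ½ + (½ + ½) → IsRicciCurvature x y x≉y κ
      curvature-2cycle {x} {y} {z} {u} {k} {κ} x≉y outˣ outʸ z→u climb-y climb-u κ+½k≈3½ =
        ricciCurvature x≉y x→y λ α 0≤α α<1 1-α<½ → wasserstein α<1 1-α<½
        where
        open OutNeighbours outˣ using () renaming (arcʳ to x→y)
        walk-y : Walk x y 1
        walk-y = step x→y (stop reflᵛ)

        wasserstein : ∀ {α} → α < 1# → 1# - α < ½ →
          ∃[ w ] IsWasserstein d (lazyWalk α x) (lazyWalk α y) w × (w + (1# - α) * κ ≈ 1#)
        wasserstein {α} α<1 1-α<½ =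
            _
          , steepest⇒optimal isDistance φ plan
              (steep-refl x ∷ steep-refl y ∷ steep walk-y climb-y ∷ steep z→u climb-u ∷ [])
          , (begin
          q * fromℕ (d x x) + (q * fromℕ (d y y) + (rest * fromℕ (d x y) + (q * fromℕ (d z u) + 0#)))
            + β * κ
            ≈⟨ +-congʳ (+-cong (m*d q (dist-refl x)) (+-cong (m*d q (dist-refl y))
                 (+-cong (m*d rest (dist walk-y climb-y)) (+-congʳ (m*d q (dist z→u climb-u)))))) ⟩
          q * fromℕ 0 + (q * fromℕ 0 + (rest * fromℕ 1 + (q * fromℕ k + 0#))) + β * κ
            ≈⟨ solve 5 (λ β ½ r k κ →
                 β :* ½ :* con 0 :+ (β :* ½ :* con 0 :+ (r :* (con 1 :+ con 0)
                   :+ (β :* ½ :* k :+ con 0))) :+ β :* κ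
                 := r :+ β :* (κ :+ ½ :* k))
                 refl β ½ rest (fromℕ k) κ ⟩
          rest + β * (κ + ½ * fromℕ k)
            ≈⟨ +-congˡ (*-congˡ κ+½k≈3½) ⟩
          rest + β * (½ + (½ + ½))
            ≈⟨ solve 3 (λ β ½ r → r :+ β :* (½ :+ (½ :+ ½)) := r :+ β :* ½ :+ (β :* ½ :+ β :* ½))
                 refl β ½ rest ⟩
          rest + q + (q + q)
            ≈⟨ rest+3q≈1 ⟩
          1#
            ∎)
          where
          open Masses α<1 1-α<½
          β = 1# - α
          P : Plan
          P = (q , x , x) ∷ (q , y , y) ∷ (rest , x , y) ∷ (q , z , u) ∷ []
          plan : PlanBetween (lazyWalk α x) (lazyWalk α y) P
          plan = record
            { nonNegative = 0≤q ∷ 0≤q ∷ 0≤rest ∷ 0≤q ∷ []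
            ; totalMass   = trans
                (solve 2 (λ q r → q :* con 1 :+ (q :* con 1 :+ (r :* con 1 :+ (q :* con 1 :+ con 0)))
                                  := r :+ q :+ (q :+ q)) refl q rest)
                rest+3q≈1
            ; sources     = λ v → trans
                (solve 5 (λ q r x y z → q :* x :+ (q :* y :+ (r :* x :+ (q :* z :+ con 0)))
                                        := (r :+ q) :* x :+ (q :* z :+ q :* y))
                  refl q rest (δ x v) (δ y v) (δ z v))
                (trans (+-congʳ (*-congʳ rest+q≈α)) (sym (lazyWalk-δ α outˣ v)))
            ; targets     = λ v → trans
                (solve 5 (λ q r x y u → q :* x :+ (q :* y :+ (r :* y :+ (q :* u :+ con 0)))
                                        := (r :+ q) :* y :+ (q :* u :+ q :* x))
                  refl q rest (δ x v) (δ y v) (δ u v))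
                (trans (+-congʳ (*-congʳ rest+q≈α)) (sym (lazyWalk-δ α outʸ v)))
            }

-- The dihedral group: arcs, distinct elements, connectedness

module DihedralProperties (n : ℕ) (3≤n : 3 ℕ.≤ n) where
  private
    instance
      n≢0 : ℕ.NonZero n
      n≢0 = ℕ.>-nonZero (ℕₚ.≤-trans (ℕ.s≤s ℕ.z≤n) 3≤n)

    Γ = dihedralCayleyGraph n 3≤n

  open Dihedral n
  open Group (D n) using (setoid; ∙-congˡ; ∙-congʳ)
  open GroupProperties (D n) using (∙-cancelˡ; ∙-cancelʳ)
  open FiniteDigraph Γ using (Vertex; Walk; stop; step)
  open DigraphProperties Γ
  open SetoidReasoning setoid using (begin_; step-≈-⟩; step-≈-⟨; _∎)

  N : ℕ
  N = n ℕ.∸ 1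

  1+N≡n : suc N ≡ n
  1+N≡n = ℕₚ.suc-pred n

  ρ σ : ℕ → Vertex
  ρ i = a ^ i
  σ i = a ^ i ∙ b

  -- Powers grow on the left but arcs multiply on the right, so the factor has to be moved across.
  ^-∙ : ∀ (x : Vertex) i → x ^ i ∙ x ~ x ^ suc i
  ^-∙ x zero    = trans (identityˡ x) (sym (identityʳ x))
  ^-∙ x (suc i) = trans (assoc x (x ^ i) x) (∙-congˡ (^-∙ x i))

  ρ∙a : ∀ i → ρ i ∙ a ~ ρ (suc i)
  ρ∙a = ^-∙ a

  ρN∙a : ρ N ∙ a ~ ρ 0
  ρN∙a = trans (ρ∙a N) (≡.subst (λ k → a ^ k ~ ε) (≡.sym 1+N≡n) (relation aⁿ≈ε))

  σ∙b : ∀ i → σ i ∙ b ~ ρ i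
  σ∙b i = begin
    ρ i ∙ b ∙ b        ≈⟨ assoc _ _ _ ⟩
    ρ i ∙ (b ∙ b)      ≈⟨ ∙-congˡ (∙-congˡ (identityʳ b)) ⟨
    ρ i ∙ b ^ 2        ≈⟨ ∙-congˡ (relation b²≈ε) ⟩
    ρ i ∙ ε            ≈⟨ identityʳ _ ⟩
    ρ i                ∎

  a~ρ1 : a ~ ρ 1
  a~ρ1 = sym (identityʳ a)

  b~σ0 : b ~ σ 0
  b~σ0 = sym (identityˡ b)

  σ0∙a : σ 0 ∙ a ~ σ N
  σ0∙a = trans (∙-congʳ (identityˡ b)) (relation ba≈)

  -- By b a = aⁿ⁻¹ b, one a of the power joins aⁿ⁻¹ to form aⁿ = e: on the elements aⁱ b, the
  -- generator a steps backwards.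
  σ∙a : ∀ i → σ (suc i) ∙ a ~ σ i
  σ∙a i = begin
    a ^ suc i ∙ b ∙ a            ≈⟨ ∙-congʳ (∙-congʳ (ρ∙a i)) ⟨
    a ^ i ∙ a ∙ b ∙ a            ≈⟨ assoc _ _ _ ⟩
    a ^ i ∙ a ∙ (b ∙ a)          ≈⟨ assoc _ _ _ ⟩
    a ^ i ∙ (a ∙ (b ∙ a))        ≈⟨ ∙-congˡ (∙-congˡ (relation ba≈)) ⟩
    a ^ i ∙ (a ∙ (a ^ N ∙ b))    ≈⟨ ∙-congˡ (assoc _ _ _) ⟨
    a ^ i ∙ (a ^ suc N ∙ b)      ≈⟨ ∙-congˡ (∙-congʳ (trans (sym (ρ∙a N)) ρN∙a)) ⟩
    a ^ i ∙ (ε ∙ b)              ≈⟨ ∙-congˡ (identityˡ b) ⟩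
    a ^ i ∙ b                    ∎

  -- The word `b ^ 0` is ε and acts as the identity, so `nf-fromNF` at the pair (0 , i) reduces to a
  -- statement about a power of a.
  nf-ρ : ∀ {i} (i<n : i ℕ.< n) → nf (ρ i) ≡ (fzero , fromℕ< i<n)
  nf-ρ i<n = ≡.subst (λ k → nf (ρ k) ≡ (fzero , fromℕ< i<n)) (toℕ-fromℕ< i<n)
    (nf-fromNF (fzero , fromℕ< i<n))

  ρ≁ρ : ∀ {i j} → i ℕ.< n → j ℕ.< n → i ≢ j → ¬ (ρ i ~ ρ j)
  ρ≁ρ i<n j<n i≢j p = i≢j (fromℕ<-injective _ _ i<n j<n (≡.cong proj₂
    (≡.trans (≡.sym (nf-ρ i<n)) (≡.trans (act-cong p _) (nf-ρ j<n)))))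

  σ≁σ : ∀ {i j} → i ℕ.< n → j ℕ.< n → i ≢ j → ¬ (σ i ~ σ j)
  σ≁σ i<n j<n i≢j p = ρ≁ρ i<n j<n i≢j (∙-cancelʳ b _ _ p)

  ρ-preserves-parity : ∀ i x → proj₁ (act (ρ i) x) ≡ proj₁ x
  ρ-preserves-parity zero    x = ≡.refl
  ρ-preserves-parity (suc i) x = ρ-preserves-parity i x

  -- The first coordinate of the normal form is an invariant parity: a preserves it and b flips it.
  ρ≁σ : ∀ i j → ¬ (ρ i ~ σ j)
  ρ≁σ i j p with ≡.trans (≡.sym (ρ-preserves-parity i _))
    (≡.trans (≡.cong proj₁ (act-cong p (fzero , 0 mod n))) (ρ-preserves-parity j _))
  ... | ()

  outNeighbours : ∀ {x y z} → x ∙ a ~ y → x ∙ b ~ z → OutNeighbours x y z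
  outNeighbours {x} xa~y xb~z = record
    { arcˡ      = here (sym xa~y)
    ; arcʳ      = there (here (sym xb~z))
    ; distinct  = λ y~z → a≁b (∙-cancelˡ x a b (trans xa~y (trans y~z (sym xb~z))))
    ; exhausted = λ where
        (here u~xa)         → inj₁ (trans u~xa xa~y)
        (there (here u~xb)) → inj₂ (trans u~xb xb~z)
    }
    where
    a≁b : ¬ (a ~ b)
    a≁b p = ρ≁σ 1 0 (trans (sym a~ρ1) (trans p b~σ0))

  neighboursIn : ∀ {x M} → x ∙ a ∈ᵛ M → x ∙ b ∈ᵛ M → OutNeighboursIn M x
  neighboursIn xa∈M xb∈M (here y~xa)         = Any.map (trans y~xa) xa∈M
  neighboursIn xa∈M xb∈M (there (here y~xb)) = Any.map (trans y~xb) xb∈M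

  infixr 5 _→ᵃ_ _→ᵇ_
  _→ᵃ_ : ∀ {x y z k} → x ∙ a ~ y → Walk y z k → Walk x z (suc k)
  xa~y →ᵃ w = step (here (sym xa~y)) w

  _→ᵇ_ : ∀ {x y z k} → x ∙ b ~ y → Walk y z k → Walk x z (suc k)
  xb~y →ᵇ w = step (there (here (sym xb~y))) w

  walk-ρ : ∀ {x y z k} i → x ∙ ρ i ~ y → Walk y z k → Walk x z (i ℕ.+ k)
  walk-ρ zero    eq w = Walk-respˡ (trans (sym eq) (identityʳ _)) w
  walk-ρ (suc i) eq w = refl →ᵃ walk-ρ i (trans (assoc _ _ _) eq) w

  walk-b^ : ∀ {x y} (j : Fin 2) → x ∙ b ^ toℕ j ~ y → Walk x y (toℕ j)
  walk-b^ fzero        eq = stop (trans (sym (identityʳ _)) eq)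
  walk-b^ (fsuc fzero) eq = trans (∙-congˡ (sym (identityʳ b))) eq →ᵇ stop refl

  -- The normal form aⁱ bʲ of x⁻¹ y contains no inverses, so it spells a directed walk from x to y.
  connected : ∀ x y → ∃[ k ] Walk x y k
  connected x y = _ , walk-ρ (toℕ i) refl (walk-b^ j (begin
    x ∙ a ^ toℕ i ∙ b ^ toℕ j     ≈⟨ assoc _ _ _ ⟩
    x ∙ fromNF (j , i)            ≈⟨ ∙-congˡ (fromNF-nf (x ⁻¹ ∙ y)) ⟩
    x ∙ (x ⁻¹ ∙ y)                ≈⟨ assoc _ _ _ ⟨
    x ∙ x ⁻¹ ∙ y                  ≈⟨ ∙-congʳ (inverseʳ x) ⟩
    ε ∙ y                         ≈⟨ identityˡ y ⟩
    y                             ∎))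
    where
    j = proj₁ (nf (x ⁻¹ ∙ y))
    i = proj₂ (nf (x ⁻¹ ∙ y))

  module DihedralCurvature {c ℓ₁ ℓ₂} (ℝ : RealNumbers c ℓ₁ ℓ₂) where
    open RealNumbers ℝ using (_≈_; _+_; _*_; ½; fromℕ)
    open Curvature ℝ Γ
    open Transport ℝ Γ using (curvature-forward; curvature-2cycle)

    -- The remaining vertices of the plan are z = b, u = a² and t = a b; k measures the transport
    -- from b to a².
    curvature-a : ∀ {k κ} (φ : Potential) → let open Potential φ using (height) in
      Walk (σ 0) (ρ 2) k → height (ρ 1) ≡ 1 ℕ.+ height (ρ 0) →
      height (σ 1) ≡ 2 ℕ.+ height (ρ 0) → height (ρ 2) ≡ k ℕ.+ height (σ 0) →
      κ + ½ * fromℕ k ≈ ½ → IsRicciCurvature ε a (e≉a n 3≤n) κ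
    curvature-a φ σ0→ρ2 climb-a climb-ab climb-a² = curvature-forward
      (proj₂ (distance connected)) φ (e≉a n 3≤n)
      (outNeighbours (identityˡ a) refl)
      (outNeighbours (trans (∙-congʳ a~ρ1) (ρ∙a 1)) (∙-congʳ a~ρ1))
      σ0→ρ2 (≡.trans (Potential.cong φ a~ρ1) climb-a) climb-ab climb-a²

    -- Here b b = e closes the 2-cycle, and the two other out-neighbours are z = a and u = b a =
    -- aⁿ⁻¹ b.
    curvature-b : ∀ {k κ} (φ : Potential) → let open Potential φ using (height) in
      Walk (ρ 1) (σ N) k → height (σ 0) ≡ 1 ℕ.+ height (ρ 0) →
      height (σ N) ≡ k ℕ.+ height (ρ 1) →
      κ + ½ * fromℕ k ≈ ½ + (½ + ½) → IsRicciCurvature ε b (e≉b n 3≤n) κ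
    curvature-b φ ρ1→σN climb-b climb-ba = curvature-2cycle
      (proj₂ (distance connected)) φ (e≉b n 3≤n)
      (outNeighbours (ρ∙a 0) (identityˡ b))
      (outNeighbours (trans (∙-congʳ b~σ0) σ0∙a) (trans (∙-congʳ b~σ0) (σ∙b 0)))
      ρ1→σN (≡.trans (Potential.cong φ b~σ0) climb-b) climb-ba

-- Potentials for n = 3

module Order3 (3≤3 : 3 ℕ.≤ 3) where
  open DihedralProperties 3 3≤3
  open Dihedral 3 using (refl; sym)
  open DigraphProperties (dihedralCayleyGraph 3 3≤3)
  open FiniteDigraph (dihedralCayleyGraph 3 3≤3) using (stop)

  private
    0<3 : 0 ℕ.< 3
    0<3 = ℕ.z<s
    1<3 : 1 ℕ.< 3
    1<3 = ℕ.s<s ℕ.z<s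
    2<3 : 2 ℕ.< 3
    2<3 = ℕ.s<s (ℕ.s<s ℕ.z<s)

  -- The distance from {b , e}, capped at 2. Starting from b alone would fail: e would have height
  -- 1, but a b = b a² only height 2 instead of 3.
  layersᵃ : Layered ((σ 0 ∷ ρ 0 ∷ []) ∷ (ρ 1 ∷ σ 2 ∷ σ 0 ∷ ρ 0 ∷ []) ∷ [])
  layersᵃ =
    ( neighboursIn (there (here σ0∙a)) (there (there (there (here (σ∙b 0)))))
    ∷ neighboursIn (here (ρ∙a 0)) (there (there (here refl)))
    ∷ []) ∷ [ _ ]

  κ-a : ∀ {c ℓ₁ ℓ₂} (ℝ : RealNumbers c ℓ₁ ℓ₂) → let open RealNumbers ℝ in
        Curvature.IsRicciCurvature ℝ (dihedralCayleyGraph 3 3≤3) ε a (e≉a 3 3≤3) (- ½)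
  κ-a ℝ = DihedralCurvature.curvature-a ℝ (layerPotential layersᵃ)
    (σ0∙a →ᵃ σ∙b 2 →ᵇ stop refl)
    (layers-climb layersᵃ 1 (here (there (here refl)))
      (there (ρ≁σ 1 0 ∷ ρ≁ρ 1<3 0<3 (λ ()) ∷ []) (here (here refl))))
    (layers-climb layersᵃ 2 (here (there (here refl)))
      (there (σ≁σ 1<3 0<3 (λ ()) ∷ ρ≁σ 0 1 ∘ sym ∷ [])
        (there (ρ≁σ 1 1 ∘ sym ∷ σ≁σ 1<3 2<3 (λ ()) ∷ σ≁σ 1<3 0<3 (λ ()) ∷ ρ≁σ 0 1 ∘ sym ∷ []) below)))
    (layers-climb layersᵃ 2 (here (here refl))
      (there (ρ≁σ 2 0 ∷ ρ≁ρ 2<3 0<3 (λ ()) ∷ [])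
        (there (ρ≁ρ 2<3 1<3 (λ ()) ∷ ρ≁σ 2 2 ∷ ρ≁σ 2 0 ∷ ρ≁ρ 2<3 0<3 (λ ()) ∷ []) below)))
    (RealProperties.-½+½*2≈½ ℝ)

  -- The distance from {e , a}, capped at 2, so that e climbs to b by 1 and a climbs to b a = a² b
  -- by 2.
  layersᵇ : Layered ((ρ 0 ∷ ρ 1 ∷ []) ∷ (σ 0 ∷ ρ 2 ∷ σ 1 ∷ ρ 0 ∷ ρ 1 ∷ []) ∷ [])
  layersᵇ =
    ( neighboursIn (there (there (there (there (here (ρ∙a 0)))))) (here refl)
    ∷ neighboursIn (there (here (ρ∙a 1))) (there (there (here refl)))
    ∷ []) ∷ [ _ ]

  κ-b : ∀ {c ℓ₁ ℓ₂} (ℝ : RealNumbers c ℓ₁ ℓ₂) → let open RealNumbers ℝ in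
        Curvature.IsRicciCurvature ℝ (dihedralCayleyGraph 3 3≤3) ε b (e≉b 3 3≤3) ½
  κ-b ℝ = DihedralCurvature.curvature-b ℝ (layerPotential layersᵇ)
    (ρ∙a 1 →ᵃ refl →ᵇ stop refl)
    (layers-climb layersᵇ 1 (here (here refl))
      (there (ρ≁σ 0 0 ∘ sym ∷ ρ≁σ 1 0 ∘ sym ∷ []) (here (here refl))))
    (layers-climb layersᵇ 2 (here (there (here refl)))
      (there (ρ≁σ 0 2 ∘ sym ∷ ρ≁σ 1 2 ∘ sym ∷ [])
        (there (σ≁σ 2<3 0<3 (λ ()) ∷ ρ≁σ 2 2 ∘ sym ∷ σ≁σ 2<3 1<3 (λ ())
               ∷ ρ≁σ 0 2 ∘ sym ∷ ρ≁σ 1 2 ∘ sym ∷ []) below)))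
    (+-congˡ (x*2≈x+x ½))
    where
    open RealNumbers ℝ using (½; +-congˡ)
    open RealProperties ℝ using (x*2≈x+x)

-- Potentials for n ≥ 4

module Order≥4 (m : ℕ) (3≤n : 3 ℕ.≤ 4 ℕ.+ m) where
  private
    -- In this form `N` reduces to 3 + m, so an equation between different indices is refuted by an
    -- absurd pattern.
    n = 4 ℕ.+ m

  open DihedralProperties n 3≤n
  open Dihedral n using (refl; sym)
  open DigraphProperties (dihedralCayleyGraph n 3≤n)
  open FiniteDigraph (dihedralCayleyGraph n 3≤n) using (stop)

  private
    0<n : 0 ℕ.< n
    0<n = ℕ.z<s
    1<n : 1 ℕ.< n
    1<n = ℕ.s<s ℕ.z<s
    2<n : 2 ℕ.< n
    2<n = ℕ.s<s (ℕ.s<s ℕ.z<s)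
    N-1<n : 2 ℕ.+ m ℕ.< n
    N-1<n = ℕₚ.n≤1+n (3 ℕ.+ m)
    N<n : 3 ℕ.+ m ℕ.< n
    N<n = ℕₚ.≤-refl

  -- The distance from b, capped at 3. As b b = e, a geodesic from b to a² runs through e and a, so
  -- one height serves all the masses. Height 3 for a b and a² rests on 1 ≠ N - 1 and 2 ≠ N, hence
  -- on n ≥ 4.
  layersᵃ : Layered ((σ 0 ∷ []) ∷ (ρ 0 ∷ σ N ∷ σ 0 ∷ []) ∷
                     (ρ 1 ∷ ρ N ∷ σ (2 ℕ.+ m) ∷ ρ 0 ∷ σ N ∷ σ 0 ∷ []) ∷ [])
  layersᵃ =
    (neighboursIn (there (here σ0∙a)) (here (σ∙b 0)) ∷ []) ∷
    ( neighboursIn (here (ρ∙a 0)) (there (there (there (there (there (here refl))))))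
    ∷ neighboursIn (there (there (here (σ∙a (2 ℕ.+ m))))) (there (here (σ∙b N)))
    ∷ neighboursIn (there (there (there (there (here σ0∙a))))) (there (there (there (here (σ∙b 0)))))
    ∷ []) ∷ [ _ ]

  κ-a : ∀ {c ℓ₁ ℓ₂} (ℝ : RealNumbers c ℓ₁ ℓ₂) → let open RealNumbers ℝ in
        Curvature.IsRicciCurvature ℝ (dihedralCayleyGraph n 3≤n) ε a (e≉a n 3≤n) (- 1#)
  κ-a ℝ = DihedralCurvature.curvature-a ℝ (layerPotential layersᵃ)
    (σ∙b 0 →ᵇ ρ∙a 0 →ᵃ ρ∙a 1 →ᵃ stop refl)
    (layers-climb layersᵃ 1 (there (ρ≁σ 0 0 ∷ []) (here (here refl)))
      (there (ρ≁σ 1 0 ∷ [])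
        (there (ρ≁ρ 1<n 0<n (λ ()) ∷ ρ≁σ 1 N ∷ ρ≁σ 1 0 ∷ []) (here (here refl)))))
    (layers-climb layersᵃ 2 (there (ρ≁σ 0 0 ∷ []) (here (here refl)))
      (there (σ≁σ 1<n 0<n (λ ()) ∷ [])
        (there (ρ≁σ 0 1 ∘ sym ∷ σ≁σ 1<n N<n (λ ()) ∷ σ≁σ 1<n 0<n (λ ()) ∷ [])
          (there (ρ≁σ 1 1 ∘ sym ∷ ρ≁σ N 1 ∘ sym ∷ σ≁σ 1<n N-1<n (λ ())
                 ∷ ρ≁σ 0 1 ∘ sym ∷ σ≁σ 1<n N<n (λ ()) ∷ σ≁σ 1<n 0<n (λ ()) ∷ []) below))))
    (layers-climb layersᵃ 3 (here (here refl))
      (there (ρ≁σ 2 0 ∷ [])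
        (there (ρ≁ρ 2<n 0<n (λ ()) ∷ ρ≁σ 2 N ∷ ρ≁σ 2 0 ∷ [])
          (there (ρ≁ρ 2<n 1<n (λ ()) ∷ ρ≁ρ 2<n N<n (λ ()) ∷ ρ≁σ 2 (2 ℕ.+ m)
                 ∷ ρ≁ρ 2<n 0<n (λ ()) ∷ ρ≁σ 2 N ∷ ρ≁σ 2 0 ∷ []) below))))
    (RealProperties.-1+½*3≈½ ℝ)

  -- The minimum of d(a , x), 1 + d(e , x) and 3. The vertex e is placed in the second layer
  -- although no arc leads there from a, so that b lies exactly 1 above e. Height 3 for aⁿ⁻¹ b rests
  -- on N ≠ 2.
  layersᵇ : Layered ((ρ 1 ∷ []) ∷ (ρ 0 ∷ ρ 2 ∷ σ 1 ∷ ρ 1 ∷ []) ∷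
                     (σ 0 ∷ ρ 3 ∷ σ 2 ∷ ρ 0 ∷ ρ 2 ∷ σ 1 ∷ ρ 1 ∷ []) ∷ [])
  layersᵇ =
    (neighboursIn (there (here (ρ∙a 1))) (there (there (here refl))) ∷ []) ∷
    ( neighboursIn (there (there (there (there (there (there (here (ρ∙a 0)))))))) (here refl)
    ∷ neighboursIn (there (here (ρ∙a 2))) (there (there (here refl)))
    ∷ neighboursIn (here (σ∙a 0)) (there (there (there (there (there (there (here (σ∙b 1))))))))
    ∷ neighboursIn (there (there (there (there (here (ρ∙a 1))))))
                   (there (there (there (there (there (here refl))))))
    ∷ []) ∷ [ _ ]

  κ-b : ∀ {c ℓ₁ ℓ₂} (ℝ : RealNumbers c ℓ₁ ℓ₂) → let open RealNumbers ℝ in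
        Curvature.IsRicciCurvature ℝ (dihedralCayleyGraph n 3≤n) ε b (e≉b n 3≤n) 0#
  κ-b ℝ = DihedralCurvature.curvature-b ℝ (layerPotential layersᵇ)
    (refl →ᵇ σ∙a 0 →ᵃ σ0∙a →ᵃ stop refl)
    (layers-climb layersᵇ 1 (there (ρ≁ρ 0<n 1<n (λ ()) ∷ []) (here (here refl)))
      (there (ρ≁σ 1 0 ∘ sym ∷ [])
        (there (ρ≁σ 0 0 ∘ sym ∷ ρ≁σ 2 0 ∘ sym ∷ σ≁σ 0<n 1<n (λ ()) ∷ ρ≁σ 1 0 ∘ sym ∷ [])
          (here (here refl)))))
    (layers-climb layersᵇ 3 (here (here refl))
      (there (ρ≁σ 1 N ∘ sym ∷ [])
        (there (ρ≁σ 0 N ∘ sym ∷ ρ≁σ 2 N ∘ sym ∷ σ≁σ N<n 1<n (λ ()) ∷ ρ≁σ 1 N ∘ sym ∷ [])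
          (there (σ≁σ N<n 0<n (λ ()) ∷ ρ≁σ 3 N ∘ sym ∷ σ≁σ N<n 2<n (λ ())
                 ∷ ρ≁σ 0 N ∘ sym ∷ ρ≁σ 2 N ∘ sym ∷ σ≁σ N<n 1<n (λ ()) ∷ ρ≁σ 1 N ∘ sym ∷ []) below))))
    (ℝ.trans (ℝ.+-identityˡ _) (RealProperties.x*3≈x+[x+x] ℝ ℝ.½))
    where module ℝ = RealNumbers ℝ

proposition4p1 :
    ∀ {c ℓ₁ ℓ₂} (ℝ : RealNumbers c ℓ₁ ℓ₂) (n : ℕ) (3≤n : 3 ℕ.≤ n) →
    let open RealNumbers ℝ
        open Curvature ℝ (dihedralCayleyGraph n 3≤n)
        κ⟨e,a⟩-is = IsRicciCurvature ε a (e≉a n 3≤n)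
        κ⟨e,b⟩-is = IsRicciCurvature ε b (e≉b n 3≤n)
    in ((n ≡ 3 → κ⟨e,a⟩-is (- ½)) × (4 ℕ.≤ n → κ⟨e,a⟩-is (- 1#)))
     × ((n ≡ 3 → κ⟨e,b⟩-is ½) × (4 ℕ.≤ n → κ⟨e,b⟩-is 0#))
proposition4p1 ℝ n 3≤n =
    ( (λ { ≡.refl → Order3.κ-a 3≤n ℝ })
    , (λ { (ℕ.s≤s (ℕ.s≤s (ℕ.s≤s (ℕ.s≤s _)))) → Order≥4.κ-a _ 3≤n ℝ }))
  , ( (λ { ≡.refl → Order3.κ-b 3≤n ℝ })
    , (λ { (ℕ.s≤s (ℕ.s≤s (ℕ.s≤s (ℕ.s≤s _)))) → Order≥4.κ-b _ 3≤n ℝ }))
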